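{- Let $F$ be a bipartite graph on $t$ vertices which is not a star. Then $$\lim_{r\to\infty}\pi_{rt}(rF)=\frac{3-\sqrt5}{2}.$$
   Context: A star on $t$ vertices is the graph $K_{1,t-1}$. An $m$-partite graph $G$ is a graph with a vertex partition $V = V_1\sqcup\dots\sqcup V_m$ into parts such that no edge has both ends in the same part. For disjoint vertex sets $X,Y$, the edge density is $d(X,Y) = \frac{e(X,Y)}{|X||Y|}$, where $e(X,Y)$ is the number of edges between $X$ and $Y$. The $m$-partite density of $G$ is $d_m(G) = \min_{1\le i<j\le m} d(V_i,V_j)$. A traversal of $G$ is a subgraph (on $m$ vertices) containing exactly one vertex from each part. For a graph $F'$ on $m$ vertices, $G$ contains an $F'$-traversal if some traversal of $G$ contains a copy of $F'$ as a subgraph. The critical density is $$\pi_m(F') = \sup\{\alpha\in[0,1] : \text{there exists an } m\text{ -partite graph } G \text{ with } d_m(G)\ge\alpha \text{ and no } F'\text{ -traversal}\}.$$ $rF$ denotes the graph consisting of $r$ vertex-disjoint copies of $F$.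
   Formalization: "Not a star" is read as "no connected component of F is a star (an isolated vertex counts)", which is the same for connected F; literally the claim fails, e.g. for F = 2K_2, where π_{4r}(rF) = 0 for all r ≥ 1. Also t ≥ 1 is assumed. -}

module Defs where

open import Data.Bool.Base using (Bool; true; false; T; _∧_)
open import Data.Bool.Properties using (∧-zeroʳ)
open import Data.Fin.Base as Fin using (Fin; zero; suc; remQuot)
open import Data.Fin.Properties as Fin using ()
open import Data.Integer.Base using (+_)
open import Data.List.Base
  using (List; _∷_; allFin; cartesianProduct; filter; filterᵇ; foldr; length; map)
open import Data.List.Membership.Propositional using (_∈_)
open import Data.List.Membership.Propositional.Properties using (∈-allFin; ∈-filter⁺)
open import Data.Nat.Base as ℕ using (ℕ; suc; NonZero)
open import Data.Nat.Properties using (m*n≢0)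
open import Data.Product.Base using (Σ; ∃-syntax; _×_; _,_; proj₁; proj₂; uncurry)
open import Data.Rational.Base as ℚ using (ℚ; 0ℚ; 1ℚ; ½; _/_)
open import Data.Rational.Properties as ℚ using (<-dense; <-trans)
open import Function.Base using (_∘_)
open import Function.Bundles using (_⇔_)
open import Function.Definitions using (Injective)
open import Relation.Binary.Construct.Closure.ReflexiveTransitive using (Star)
open import Relation.Binary.PropositionalEquality
  using (_≡_; _≢_; refl; sym; cong; cong₂; trans)
open import Relation.Nullary using (¬_; yes; no)
open import Relation.Nullary.Decidable using (⌊_⌋)

------------------------------------------------------------------------
-- Real numbers

-- Extended reals as lower cuts of ℚ: `x ∋ q` means q < x.  Cuts need not be
-- inhabited or bounded, so -∞ and +∞ are included and every set of rationals
-- has a supremum (with no appeal to excluded middle).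

record ℝ̄ : Set₁ where
  infix 4 _∋_
  field
    _∋_     : ℚ → Set
    lower   : ∀ {p q} → p ℚ.< q → _∋_ q → _∋_ p
    rounded : ∀ {q} → _∋_ q → ∃[ p ] q ℚ.< p × _∋_ p

open ℝ̄ public using (_∋_)

infix  4 _≤_
infixl 6 _+_ _-_
infix  8 -_ √_
infixl 7 _/2

_≤_ : ℝ̄ → ℝ̄ → Set
x ≤ y = ∀ q → x ∋ q → y ∋ q

sup : (ℚ → Set) → ℝ̄
sup S = record
  { _∋_     = λ q → ∃[ s ] S s × q ℚ.< s
  ; lower   = λ { p<q (s , Ss , q<s) → s , Ss , <-trans p<q q<s }
  ; rounded = λ { (s , Ss , q<s) → let p , q<p , p<s = <-dense q<s in
                                   p , q<p , s , Ss , p<s }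
  }

ι : ℚ → ℝ̄
ι q = sup (_≡ q)

_+_ : ℝ̄ → ℝ̄ → ℝ̄
x + y = sup λ s → ∃[ p ] ∃[ q ] x ∋ p × y ∋ q × s ≡ p ℚ.+ q

-- ¬ (x ∋ p) says x ≤ p, that is, -p ≤ -x.
-_ : ℝ̄ → ℝ̄
- x = sup λ s → ∃[ p ] ¬ (x ∋ p) × s ≡ ℚ.- p

_-_ : ℝ̄ → ℝ̄ → ℝ̄
x - y = x + (- y)

_/2 : ℝ̄ → ℝ̄
x /2 = sup λ s → ∃[ p ] x ∋ p × s ≡ ½ ℚ.* p

√_ : (a : ℚ) .{{_ : ℚ.NonNegative a}} → ℝ̄
√ a = sup λ s → s ℚ.* s ℚ.≤ a

-- Convergence to a finite limit.
_⟶_ : (ℕ → ℝ̄) → ℝ̄ → Set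
x ⟶ ℓ = ∀ ε → 0ℚ ℚ.< ε →
  ∃[ N ] ∀ n → N ℕ.≤ n → (ℓ - ι ε ≤ x n) × (x n ≤ ℓ + ι ε)

infix 4 _⟶_

------------------------------------------------------------------------
-- Graphs

record Graph (n : ℕ) : Set where
  field
    adj    : Fin n → Fin n → Bool
    symm   : ∀ u v → adj u v ≡ adj v u
    irrefl : ∀ v → adj v v ≡ false

  Adj : Fin n → Fin n → Set
  Adj u v = T (adj u v)

open Graph public using (adj; Adj)

Bipartite : ∀ {n} → Graph n → Set
Bipartite {n} G = Σ (Fin n → Bool) λ c → ∀ u v → Adj G u v → c u ≢ c v

-- The star K_{1,s}, with centre zero.
K₁ : ∀ s → Graph (suc s)
K₁ s = record { adj = a ; symm = a-sym ; irrefl = a-irr }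
  where
  a : Fin (suc s) → Fin (suc s) → Bool
  a zero    zero    = false
  a zero    (suc _) = true
  a (suc _) zero    = true
  a (suc _) (suc _) = false

  a-sym : ∀ u v → a u v ≡ a v u
  a-sym zero    zero    = refl
  a-sym zero    (suc _) = refl
  a-sym (suc _) zero    = refl
  a-sym (suc _) (suc _) = refl

  a-irr : ∀ v → a v v ≡ false
  a-irr zero    = refl
  a-irr (suc _) = refl

-- Some connected component of G is isomorphic to K_{1,s} for some s ≥ 0 (so
-- isolated vertices count); f is the isomorphism onto that component.
-- For connected G this says that G is a star.  For disconnected G it is the
-- relevant condition: 2K₂ is not a star, yet π (r * 4) (copies r 2K₂) = 0 for
-- r ≥ 1, as V₁V₂, V₃V₄, … each span an edge once all densities are positive.
HasStarComponent : ∀ {n} → Graph n → Set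
HasStarComponent {n} G =
  ∃[ s ] Σ (Fin (suc s) → Fin n) λ f →
    Injective _≡_ _≡_ f
    × (∀ i j → adj G (f i) (f j) ≡ adj (K₁ s) i j)
    × (∀ v → Star (Adj G) (f zero) v ⇔ (∃[ i ] f i ≡ v))

-- H is isomorphic to a (not necessarily induced) subgraph of G.
_⊑_ : ∀ {m n} → Graph m → Graph n → Set
_⊑_ {m} {n} H G =
  Σ (Fin m → Fin n) λ φ →
    Injective _≡_ _≡_ φ × (∀ u v → Adj H u v → Adj G (φ u) (φ v))

pullback : ∀ {m n} (f : Fin m → Fin n) → Graph n → Graph m
pullback f G = record
  { adj    = λ u v → adj G (f u) (f v)
  ; symm   = λ u v → Graph.symm G (f u) (f v)
  ; irrefl = λ v → Graph.irrefl G (f v)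
  }

-- r disjoint copies of F: a vertex i of Fin (r * t) is vertex
-- proj₂ (remQuot t i) of copy number proj₁ (remQuot t i).
copies : ∀ r {t} → Graph t → Graph (r ℕ.* t)
copies r {t} F = record
  { adj    = λ u v → ⌊ copy u Fin.≟ copy v ⌋ ∧ adj F (vertex u) (vertex v)
  ; symm   = λ u v → cong₂ _∧_ (≟-sym (copy u) (copy v))
                               (Graph.symm F (vertex u) (vertex v))
  ; irrefl = λ v → trans (cong (⌊ copy v Fin.≟ copy v ⌋ ∧_)
                               (Graph.irrefl F (vertex v)))
                         (∧-zeroʳ _)
  }
  where
  copy : Fin (r ℕ.* t) → Fin r
  copy = proj₁ ∘ remQuot t

  vertex : Fin (r ℕ.* t) → Fin t
  vertex = proj₂ ∘ remQuot {r} t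

  ≟-sym : ∀ (i j : Fin r) → ⌊ i Fin.≟ j ⌋ ≡ ⌊ j Fin.≟ i ⌋
  ≟-sym i j with i Fin.≟ j | j Fin.≟ i
  ... | yes _   | yes _   = refl
  ... | no  _   | no  _   = refl
  ... | yes i≡j | no  j≢i with () ← j≢i (sym i≡j)
  ... | no  i≢j | yes j≡i with () ← i≢j (sym j≡i)

------------------------------------------------------------------------
-- Multipartite graphs

-- Parts are nonempty, since otherwise densities are undefined.
record MultipartiteGraph (m : ℕ) : Set where
  field
    {order}     : ℕ
    graph       : Graph order
    class       : Fin order → Fin m
    independent : ∀ u v → Adj graph u v → class u ≢ class v
    nonempty    : ∀ i → ∃[ v ] class v ≡ i

  part : Fin m → List (Fin order)
  part i = filter (λ v → class v Fin.≟ i) (allFin order)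

  part-nonZero : ∀ i → NonZero (length (part i))
  part-nonZero i with nonempty i
  ... | v , v∈i = ∈⇒nonZero (∈-filter⁺ (λ u → class u Fin.≟ i) (∈-allFin v) v∈i)
    where
    ∈⇒nonZero : ∀ {xs : List (Fin order)} → v ∈ xs → NonZero (length xs)
    ∈⇒nonZero {_ ∷ _} _ = _

  edges : List (Fin order) → List (Fin order) → ℕ
  edges X Y = length (filterᵇ (uncurry (adj graph)) (cartesianProduct X Y))

  density : Fin m → Fin m → ℚ
  density i j = (+ edges (part i) (part j)) / (length (part i) ℕ.* length (part j))
    where instance
    nonZero : NonZero (length (part i) ℕ.* length (part j))
    nonZero = m*n≢0 _ _ {{part-nonZero i}} {{part-nonZero j}}

  -- The minimum of the densities d(Vᵢ, Vⱼ) over i < j.  All of them are at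
  -- most 1, so the initial value 1 matters only when m ≤ 1.
  partiteDensity : ℚ
  partiteDensity =
    foldr ℚ._⊓_ 1ℚ
      (map (uncurry density)
        (filter (λ (i , j) → i Fin.<? j) (cartesianProduct (allFin m) (allFin m))))

open MultipartiteGraph public using (graph; class; partiteDensity)

-- s picks one vertex from each part.  Every traversal on these vertices is a
-- subgraph of the induced one, so only the induced one needs considering.
HasTraversal : ∀ {m} → Graph m → MultipartiteGraph m → Set
HasTraversal {m} F′ G =
  ∃[ s ] (∀ i → class G (s i) ≡ i) × F′ ⊑ pullback s (graph G)

-- α may be taken rational, since densities are.
π : ∀ m → Graph m → ℝ̄
π m F′ = sup λ α →
  0ℚ ℚ.≤ α × α ℚ.≤ 1ℚ ×
  Σ (MultipartiteGraph m) λ G → α ℚ.≤ partiteDensity G × ¬ HasTraversal F′ G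

{-# OPTIONS --safe #-}

-- Write τ = (3 − √5) / 2; it is the root of x = (1 − x)² in [0, 1].
--
-- Lower bound.  Split every part into an A-side of proportion α < τ and a
-- B-side.  Join the zeroth part to all A-sides, and the B-sides of the other
-- parts to each other.  All densities are at least min(α, (1 − α)²) = α, but in
-- a traversal the neighbours of the zeroth vertex have no other neighbour, so
-- its component is a star.
--
-- Upper bound.  Let all densities exceed c / E > τ.  Any given part contains a
-- vertex x with at least c / E of P i as neighbours, for many i.  For two such
-- parts, one direction has many paths x ~ y ~ z with y ∈ P i, z ∈ P j, since
-- c / E > (1 − c / E)².  Orienting pairs accordingly, a tournament argument
-- gives two families of parts, all pairs of which are dense, and averaging
-- followed by the Kővári–Sós–Turán argument gives a biclique traversal through x.
-- To tile all parts by copies of F, reserve a large biclique, tile the rest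
-- greedily up to boundedly many parts, cover these using one side of the
-- reserve, rebalance the two sides and tile what is left of the biclique by
-- pairs of copies of F with opposite bipartitions.

module Submission where

open import Defs renaming (_≤_ to _≤ᴿ_; _+_ to _+ᴿ_)

open import Algebra.Solver.CommutativeMonoid as MonoidSolver using ()
open import Data.Bool.Base using (Bool; true; false; T; not; _∧_; if_then_else_)
open import Data.Bool.Properties using (T-∧; T-≡; T?; ∧-comm; ∧-zeroʳ; not-injective)
open import Data.Empty using (⊥-elim)
open import Data.Fin.Base as Fin using (Fin; zero; suc; toℕ; combine; remQuot; punchOut)
open import Data.Fin.Properties as Fin
  using (any?; combine-injectiveʳ; combine-remQuot; remQuot-combine; injective⇒≤; punchOut-injective)
open import Data.Integer.Base as ℤ using (+_; -[1+_])
open import Data.Integer.Properties as ℤ using ()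
open import Data.Integer.Solver as ℤ using ()
open import Data.List.Base
  using ( List; []; _∷_; _++_; length; map; foldr; take; drop; lookup; tabulate; allFin
        ; filter; filterᵇ; cartesianProduct)
open import Data.List.Membership.Propositional using (_∈_)
open import Data.List.Membership.Propositional.Properties
  using ( ∈-++⁺ˡ; ∈-++⁺ʳ; ∈-++⁻; ∈-map⁺; ∈-map⁻; ∈-filter⁺; ∈-filter⁻; ∈-lookup
        ; ∈-tabulate⁺; ∈-tabulate⁻; ∈-allFin; ∈-cartesianProduct⁺)
open import Data.List.Properties
  using ( length-++; length-map; length-take; length-tabulate; map-++; map-tabulate
        ; take++drop≡id; ++-assoc; ++-identityʳ; ∷-injective)
open import Data.List.Relation.Binary.Permutation.Propositional
  using (_↭_; prep; ↭-refl; ↭-sym; ↭-trans; ↭-reflexive; ↭⇒↭ₛ; module PermutationReasoning)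
open import Data.List.Relation.Binary.Permutation.Propositional.Properties
  using ( ++⁺; ++⁺ˡ; ++⁺ʳ; shift; shifts; ++-comm; ↭-length; ∈-resp-↭; map⁺; ↭-map-inv; ↭-empty-inv
        ; ++-commutativeMonoid)
open import Data.List.Relation.Binary.Permutation.Setoid.Properties as SetoidPerm using ()
open import Data.List.Relation.Unary.All as All using (All; []; _∷_)
open import Data.List.Relation.Unary.All.Properties using (++⁻ˡ)
open import Data.List.Relation.Unary.AllPairs using ([]; _∷_)
open import Data.List.Relation.Unary.Any as Any using (here; there)
open import Data.List.Relation.Unary.Any.Properties using (lookup-index)
open import Data.List.Relation.Unary.Unique.Propositional using (Unique)
open import Data.List.Relation.Unary.Unique.Propositional.Properties using (allFin⁺; filter⁺)
open import Data.Nat.Base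
  using ( ℕ; zero; suc; pred; _+_; _*_; _∸_; _^_; _≤_; _<_; _≤ᵇ_; _<ᵇ_; z≤n; s≤s
        ; NonZero; >-nonZero; >-nonZero⁻¹)
open import Data.Nat.Properties hiding (_≟_)
open import Data.Nat.Solver using (module +-*-Solver)
open import Data.Product.Base using (Σ; ∃-syntax; _×_; _,_; proj₁; proj₂; uncurry)
open import Data.Rational.Base as ℚ using (ℚ; mkℚ; 0ℚ; 1ℚ; ½; _/_; _⊓_; toℚᵘ)
open import Data.Rational.Properties as ℚ using ()
open import Data.Rational.Solver as ℚ using ()
open import Data.Rational.Unnormalised.Base as ℚᵘ using ()
open import Data.Rational.Unnormalised.Properties as ℚᵘ using ()
open import Data.Sum.Base using (_⊎_; inj₁; inj₂)
open import Function.Base using (_∘_; id)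
open import Function.Bundles using (Equivalence; mk⇔)
open import Function.Definitions using (Injective)
open import Relation.Binary.Construct.Closure.ReflexiveTransitive using (Star; _◅_) renaming (ε to nil)
open import Relation.Binary.Definitions using (tri<; tri≈; tri>)
open import Relation.Binary.PropositionalEquality
open import Relation.Nullary using (¬_; Dec; does; yes; no)
open import Relation.Nullary.Decidable using (⌊_⌋; toWitness; fromWitness)

private variable
  A B : Set

-- Counting by sums over lists

∑ : List A → (A → ℕ) → ℕ
∑ []       f = 0
∑ (x ∷ xs) f = f x + ∑ xs f

𝟙 : Bool → ℕ
𝟙 b = if b then 1 else 0

# : (A → Bool) → List A → ℕ
# p xs = ∑ xs (𝟙 ∘ p)

∑-mono : ∀ (xs : List A) {f g} → (∀ {x} → x ∈ xs → f x ≤ g x) → ∑ xs f ≤ ∑ xs g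
∑-mono []       h = z≤n
∑-mono (x ∷ xs) h = +-mono-≤ (h (here refl)) (∑-mono xs (h ∘ there))

∑-cong : ∀ (xs : List A) {f g} → (∀ x → f x ≡ g x) → ∑ xs f ≡ ∑ xs g
∑-cong []       h = refl
∑-cong (x ∷ xs) h = cong₂ _+_ (h x) (∑-cong xs h)

∑-+ : ∀ (xs : List A) f g → ∑ xs (λ x → f x + g x) ≡ ∑ xs f + ∑ xs g
∑-+ []       f g = refl
∑-+ (x ∷ xs) f g rewrite ∑-+ xs f g =
  solve 4 (λ a b c d → a :+ b :+ (c :+ d) := a :+ c :+ (b :+ d)) refl (f x) (g x) (∑ xs f) (∑ xs g)
  where open +-*-Solver

∑-* : ∀ (xs : List A) k f → ∑ xs (λ x → k * f x) ≡ k * ∑ xs f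
∑-* []       k f = sym (*-zeroʳ k)
∑-* (x ∷ xs) k f rewrite ∑-* xs k f = sym (*-distribˡ-+ k (f x) (∑ xs f))

∑-const : ∀ (xs : List A) k → ∑ xs (λ _ → k) ≡ k * length xs
∑-const []       k = sym (*-zeroʳ k)
∑-const (x ∷ xs) k rewrite ∑-const xs k = sym (*-suc k (length xs))

∑-swap : ∀ (xs : List A) (ys : List B) (f : A → B → ℕ) →
  ∑ xs (λ x → ∑ ys (f x)) ≡ ∑ ys (λ y → ∑ xs (λ x → f x y))
∑-swap []       ys f = sym (∑-const ys 0)
∑-swap (x ∷ xs) ys f rewrite ∑-swap xs ys f =
  sym (∑-+ ys (f x) (λ y → ∑ xs (λ x → f x y)))

∑-map : ∀ (g : B → A) (xs : List B) f → ∑ (map g xs) f ≡ ∑ xs (f ∘ g)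
∑-map g []       f = refl
∑-map g (x ∷ xs) f = cong (λ s → f (g x) + s) (∑-map g xs f)

∑-++ : ∀ (xs ys : List A) f → ∑ (xs ++ ys) f ≡ ∑ xs f + ∑ ys f
∑-++ []       ys f = refl
∑-++ (x ∷ xs) ys f rewrite ∑-++ xs ys f = sym (+-assoc (f x) _ _)

∑-cartesianProduct : ∀ (xs : List A) (ys : List B) f →
  ∑ (cartesianProduct xs ys) f ≡ ∑ xs (λ x → ∑ ys (λ y → f (x , y)))
∑-cartesianProduct []       ys f = refl
∑-cartesianProduct (x ∷ xs) ys f = trans (∑-++ (map (x ,_) ys) _ f)
  (cong₂ _+_ (∑-map (x ,_) ys f) (∑-cartesianProduct xs ys f))

length-filterᵇ : ∀ (p : A → Bool) xs → length (filterᵇ p xs) ≡ # p xs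
length-filterᵇ p []       = refl
length-filterᵇ p (x ∷ xs) with p x
... | true  = cong suc (length-filterᵇ p xs)
... | false = length-filterᵇ p xs

𝟙≤1 : ∀ b → 𝟙 b ≤ 1
𝟙≤1 true  = ≤-refl
𝟙≤1 false = z≤n

#≤length : ∀ (p : A → Bool) xs → # p xs ≤ length xs
#≤length p xs = begin
  # p xs           ≤⟨ ∑-mono xs (λ {x} _ → 𝟙≤1 (p x)) ⟩
  ∑ xs (λ _ → 1)   ≡⟨ ∑-const xs 1 ⟩
  1 * length xs    ≡⟨ *-identityˡ _ ⟩
  length xs        ∎
  where open ≤-Reasoning

average-∷ : ∀ (x : A) xs f g → ∑ (x ∷ xs) g ≤ ∑ (x ∷ xs) f →
  ∃[ y ] y ∈ x ∷ xs × g y ≤ f y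
average-∷ x []       f g le = x , here refl ,
  subst₂ _≤_ (+-identityʳ (g x)) (+-identityʳ (f x)) le
average-∷ x (y ∷ ys) f g le with g x ≤? f x
... | yes gx≤fx = x , here refl , gx≤fx
... | no  gx≰fx =
  let z , z∈ , gz≤fz = average-∷ y ys f g
                         (≮⇒≥ λ lt → <⇒≱ (+-mono-< (≰⇒> gx≰fx) lt) le)
  in z , there z∈ , gz≤fz

average : ∀ (xs : List A) f g → .{{NonZero (length xs)}} → ∑ xs g ≤ ∑ xs f →
  ∃[ x ] x ∈ xs × g x ≤ f x
average (x ∷ xs) f g le = average-∷ x xs f g le

-- Markov's inequality from below. Entries under the threshold account for at most
-- `c * (n * length xs)` of `E * ∑ xs f`. The unit by which `suc c` exceeds `c` must come from the
-- good entries, and each of these gives at most `n * E`.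
markov : ∀ (xs : List A) f n c E → .{{NonZero n}} → (∀ x → f x ≤ n) →
  suc c * (n * length xs) ≤ E * ∑ xs f →
  length xs ≤ E * # (λ x → c * n ≤ᵇ E * f x) xs
markov xs f n c E f≤n le = *-cancelˡ-≤ n (+-cancelʳ-≤ (c * (n * length xs)) _ _ (begin
  suc c * (n * length xs)
    ≤⟨ le ⟩
  E * ∑ xs f
    ≡⟨ ∑-* xs E f ⟨
  ∑ xs (λ x → E * f x)
    ≤⟨ ∑-mono xs (λ {x} _ → pointwise x) ⟩
  ∑ xs (λ x → n * E * 𝟙 (good x) + c * n)
    ≡⟨ ∑-+ xs _ _ ⟩
  ∑ xs (λ x → n * E * 𝟙 (good x)) + ∑ xs (λ _ → c * n)
    ≡⟨ cong₂ _+_ (trans (∑-* xs (n * E) _) (*-assoc n E _))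
                 (trans (∑-const xs (c * n)) (*-assoc c n _)) ⟩
  n * (E * # good xs) + c * (n * length xs)
    ∎))
  where
  open ≤-Reasoning
  good : _ → Bool
  good x = c * n ≤ᵇ E * f x

  pointwise : ∀ x → E * f x ≤ n * E * 𝟙 (good x) + c * n
  pointwise x with c * n ≤ᵇ E * f x in eq
  ... | true  = m≤n⇒m≤n+o (c * n) (≤-trans (*-monoʳ-≤ E (f≤n x))
                  (≤-reflexive (trans (*-comm E n) (sym (*-identityʳ (n * E))))))
  ... | false = ≤-trans (<⇒≤ (≰⇒> λ cn≤ → subst T eq (≤⇒≤ᵇ cn≤)))
                  (m≤n+m (c * n) (n * E * 0))

-- Bicliques and tournaments

Unique-resp-↭ : {xs ys : List A} → xs ↭ ys → Unique xs → Unique ys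
Unique-resp-↭ p = SetoidPerm.Unique-resp-↭ (setoid _) (↭⇒↭ₛ p)

infix 4 _≼_

-- Containment of multisets with the complement as witness, since what is left over is the input of
-- the next step of a tiling.
_≼_ : List A → List A → Set
xs ≼ ys = ∃[ zs ] ys ↭ xs ++ zs

≼-trans : {xs ys zs : List A} → xs ≼ ys → ys ≼ zs → xs ≼ zs
≼-trans {xs = xs} (us , p) (vs , q) =
  us ++ vs , ↭-trans q (↭-trans (++⁺ʳ vs p) (↭-reflexive (++-assoc xs us vs)))

≼-++ : {xs ys us vs : List A} → xs ≼ us → ys ≼ vs → xs ++ ys ≼ us ++ vs
≼-++ {xs = xs} {ys} {us} {vs} (as , p) (bs , q) = as ++ bs , (begin
  us ++ vs               ↭⟨ ++⁺ p q ⟩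
  (xs ++ as) ++ ys ++ bs ≡⟨ ++-assoc xs as _ ⟩
  xs ++ as ++ ys ++ bs   ↭⟨ ++⁺ˡ xs (shifts as ys) ⟩
  xs ++ ys ++ as ++ bs   ≡⟨ ++-assoc xs ys _ ⟨
  (xs ++ ys) ++ as ++ bs ∎)
  where open PermutationReasoning

≼-map : (f : A → B) {xs ys : List A} → xs ≼ ys → map f xs ≼ map f ys
≼-map f {xs} (zs , p) = map f zs ,
  ↭-trans (map⁺ f p) (↭-reflexive (map-++ f xs zs))

≼-∈ : {xs ys : List A} {x : A} → xs ≼ ys → x ∈ xs → x ∈ ys
≼-∈ (_ , p) x∈ = ∈-resp-↭ (↭-sym p) (∈-++⁺ˡ x∈)

≼-Unique : {xs ys : List A} → xs ≼ ys → Unique ys → Unique xs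
≼-Unique {xs = xs} (_ , p) u = Unique-++⁻ˡ xs (Unique-resp-↭ p u)
  where
  Unique-++⁻ˡ : ∀ xs {ys : List _} → Unique (xs ++ ys) → Unique xs
  Unique-++⁻ˡ []       u        = []
  Unique-++⁻ˡ (x ∷ xs) (x∉ ∷ u) = ++⁻ˡ xs x∉ ∷ Unique-++⁻ˡ xs u

take-≼ : ∀ n (xs : List A) → take n xs ≼ xs
take-≼ n xs = drop n xs , ↭-reflexive (sym (take++drop≡id n xs))

length-take-≤ : ∀ n (xs : List A) → n ≤ length xs → length (take n xs) ≡ n
length-take-≤ n xs n≤ = trans (length-take n xs) (m≤n⇒m⊓n≡m n≤)

split : ∀ {P Q : A → Set} xs → (∀ {x} → x ∈ xs → P x ⊎ Q x) →
  ∃[ ys ] ∃[ zs ] xs ↭ ys ++ zs × All P ys × All Q zs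
split []       h = [] , [] , ↭-refl , [] , []
split (x ∷ xs) h with split xs (h ∘ there) | h (here refl)
... | ys , zs , p , Py , Qz | inj₁ Px = x ∷ ys , zs , prep x p , Px ∷ Py , Qz
... | ys , zs , p , Py , Qz | inj₂ Qx =
  ys , x ∷ zs , ↭-trans (prep x p) (↭-sym (shift x ys zs)) , Py , Qx ∷ Qz

select : ∀ (p : A → Bool) xs → ∃[ ys ] ys ≼ xs × All (T ∘ p) ys × length ys ≡ # p xs
select p []       = [] , ([] , ↭-refl) , [] , refl
select p (x ∷ xs) with select p xs | p x in eq
... | ys , (zs , q) , Py , len | true  =
  x ∷ ys , (zs , prep x q) , subst T (sym eq) _ ∷ Py , cong suc len
... | ys , (zs , q) , Py , len | false =
  ys , (x ∷ zs , ↭-trans (prep x q) (↭-sym (shift x ys zs))) , Py , len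

half : ∀ {a b m n} → m + n ≤ a + b → m ≤ a ⊎ n ≤ b
half {a} {b} {m} {n} le with m ≤? a
... | yes m≤a = inj₁ m≤a
... | no  m≰a = inj₂ (≮⇒≥ λ b<n → <⇒≱ (+-mono-< (≰⇒> m≰a) b<n) le)

-- Pigeonhole on the neighbourhoods in `Y`, one entry at a time: `Z` is split by adjacency to `y`,
-- and one of the two pieces keeps at least half of the guaranteed size, whence the factor
-- `2 ^ length Y`. The equation for the degree records that `ys` is the entire neighbourhood in `Y`,
-- not just a piece of it.
same-neighbours : ∀ (R : A → B → Bool) n Y Z → n * 2 ^ length Y ≤ length Z →
  ∃[ ys ] ∃[ Z′ ] ys ≼ Y × Z′ ≼ Z × n ≤ length Z′ ×
  (∀ {z} → z ∈ Z′ → All (λ y → T (R y z)) ys × # (λ y → R y z) Y ≡ length ys)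
same-neighbours R n []      Z le =
  [] , Z , ([] , ↭-refl) , ([] , ↭-reflexive (sym (++-identityʳ Z))) ,
  subst (_≤ length Z) (*-identityʳ n) le , λ _ → [] , refl
same-neighbours R n (y ∷ Y) Z le
  with split {P = λ z → R y z ≡ true} {Q = λ z → R y z ≡ false} Z (λ _ → classify (R y _))
  where
  classify : ∀ b → b ≡ true ⊎ b ≡ false
  classify true  = inj₁ refl
  classify false = inj₂ refl
... | Z₁ , Z₀ , p , adj₁ , adj₀
  with half {length Z₁} {length Z₀} {n * 2 ^ length Y} {n * 2 ^ length Y}
       (subst₂ _≤_
         (trans (*-distribˡ-+ n (2 ^ length Y) _)
                (cong (λ k → n * 2 ^ length Y + n * k) (+-identityʳ _)))
         (trans (↭-length p) (length-++ Z₁)) le)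
... | inj₁ le₁ =
  let ys , Z′ , (ws , ys≼) , Z′≼ , n≤ , h = same-neighbours R n Y Z₁ le₁
  in y ∷ ys , Z′ , (ws , prep y ys≼) , ≼-trans Z′≼ (Z₀ , p) , n≤ , λ z∈ →
     let Ryz = All.lookup adj₁ (≼-∈ Z′≼ z∈)
     in subst T (sym Ryz) _ ∷ proj₁ (h z∈) , cong₂ (λ b k → 𝟙 b + k) Ryz (proj₂ (h z∈))
... | inj₂ le₀ =
  let ys , Z′ , (ws , ys≼) , Z′≼ , n≤ , h = same-neighbours R n Y Z₀ le₀
  in ys , Z′ , (y ∷ ws , ↭-trans (prep y ys≼) (↭-sym (shift y ys ws))) ,
     ≼-trans Z′≼ (Z₁ , ↭-trans p (++-comm Z₁ Z₀)) , n≤ , λ z∈ →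
     let Ryz = All.lookup adj₀ (≼-∈ Z′≼ z∈)
     in proj₁ (h z∈) , cong₂ (λ b k → 𝟙 b + k) Ryz (proj₂ (h z∈))

-- By `markov`, density 2 / D makes a 1 / D share of `Z` have degree at least |Y| / D. Enough of
-- these share one neighbourhood, and its size is their common degree, hence at least `n`.
kővári-sós-turán : ∀ (R : A → B → Bool) n D Y Z → .{{NonZero n}} → .{{NonZero D}} →
  D * n ≤ length Y → D * (n * 2 ^ length Y) ≤ length Z →
  2 * (length Y * length Z) ≤ D * ∑ Z (λ z → # (λ y → R y z) Y) →
  ∃[ ys ] ∃[ zs ] ys ≼ Y × zs ≼ Z × length ys ≡ n × length zs ≡ n ×
  (∀ {y z} → y ∈ ys → z ∈ zs → T (R y z))
kővári-sós-turán R n D Y Z |Y|≥ |Z|≥ dense =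
  take n ys , take n Z′ , ≼-trans (take-≼ n ys) ys≼ ,
  ≼-trans (take-≼ n Z′) Z′≼Z , length-take-≤ n ys n≤ys , length-take-≤ n Z′ n≤Z′ ,
  λ y∈ z∈ → All.lookup (proj₁ (same (≼-∈ (take-≼ n Z′) z∈))) (≼-∈ (take-≼ n ys) y∈)
  where
  open ≤-Reasoning
  deg : _ → ℕ
  deg z = # (λ y → R y z) Y

  instance
    nonZero : NonZero (length Y)
    nonZero = >-nonZero (≤-trans (>-nonZero⁻¹ (D * n) {{m*n≢0 D n}}) |Y|≥)

  good : _ → Bool
  good z = 1 * length Y ≤ᵇ D * deg z

  many-good : length Z ≤ D * # good Z
  many-good = markov Z deg (length Y) 1 D (λ z → #≤length (λ y → R y z) Y) dense

  selected : ∃[ Zg ] Zg ≼ Z × All (T ∘ good) Zg × length Zg ≡ # good Z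
  selected = select good Z

  Zg = proj₁ selected

  found : ∃[ ys ] ∃[ Z′ ] ys ≼ Y × Z′ ≼ Zg × n ≤ length Z′ ×
    (∀ {z} → z ∈ Z′ → All (λ y → T (R y z)) ys × deg z ≡ length ys)
  found = same-neighbours R n Y Zg (*-cancelˡ-≤ D (begin
    D * (n * 2 ^ length Y) ≤⟨ |Z|≥ ⟩
    length Z               ≤⟨ many-good ⟩
    D * # good Z           ≡⟨ cong (D *_) (proj₂ (proj₂ (proj₂ selected))) ⟨
    D * length Zg          ∎))

  ys = proj₁ found
  Z′ = proj₁ (proj₂ found)
  ys≼ = proj₁ (proj₂ (proj₂ found))
  Z′≼Zg = proj₁ (proj₂ (proj₂ (proj₂ found)))
  Z′≼Z = ≼-trans Z′≼Zg (proj₁ (proj₂ selected))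
  n≤Z′ = proj₁ (proj₂ (proj₂ (proj₂ (proj₂ found))))
  same = proj₂ (proj₂ (proj₂ (proj₂ (proj₂ found))))

  member : ∀ (xs : List _) → n ≤ length xs → ∃[ x ] x ∈ xs
  member []       n≤ = ⊥-elim (<⇒≱ (>-nonZero⁻¹ n) n≤)
  member (x ∷ xs) n≤ = x , here refl

  n≤ys : n ≤ length ys
  n≤ys = let z , z∈ = member Z′ n≤Z′ in *-cancelˡ-≤ D (begin
    D * n             ≤⟨ |Y|≥ ⟩
    length Y          ≡⟨ *-identityˡ _ ⟨
    1 * length Y      ≤⟨ ≤ᵇ⇒≤ _ _ (All.lookup (proj₁ (proj₂ (proj₂ selected))) (≼-∈ Z′≼Zg z∈)) ⟩
    D * deg z         ≡⟨ cong (D *_) (proj₂ (same z∈)) ⟩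
    D * length ys     ∎)

ramsey : ℕ → ℕ → ℕ
ramsey zero    q       = q
ramsey (suc p) zero    = suc p
ramsey (suc p) (suc q) = suc (ramsey p (suc q) + ramsey (suc p) q)

-- Induction on a vertex `v`, as in Ramsey's theorem. Only pairs between `I` and `J` matter, so `v`
-- may join `I` if the rest is found among the vertices that it dominates, and `J` if the rest is
-- found among those that dominate it. The recurrence of `ramsey` makes one of these two classes
-- large enough.
dominating : ∀ (D : A → A → Set) p q L → ramsey p q ≤ length L → Unique L →
  (∀ {i j} → i ∈ L → j ∈ L → i ≢ j → D i j ⊎ D j i) →
  ∃[ I ] ∃[ J ] length I ≡ p × length J ≡ q × I ++ J ≼ L ×
  (∀ {i j} → i ∈ I → j ∈ J → D i j)
dominating D zero q L le u tot =
  [] , take q L , refl , length-take-≤ q L le , take-≼ q L , λ ()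
dominating D (suc p) zero L le u tot =
  take (suc p) L , [] , length-take-≤ (suc p) L le , refl ,
  subst (_≼ L) (sym (++-identityʳ _)) (take-≼ (suc p) L) , λ _ ()
dominating D (suc p) (suc q) (v ∷ L) (s≤s le) (v∉L ∷ u) tot
  with split {P = D v} {Q = λ j → D j v} L
         (λ j∈ → tot (here refl) (there j∈) (All.lookup v∉L j∈))
... | Out , In , perm , out , in′
  with half {length Out} {length In} (≤-trans le (≤-reflexive (trans (↭-length perm) (length-++ Out))))
... | inj₁ le₁ =
  let Out≼L = In , perm
      I , J , |I| , |J| , (rest , IJ≼) , dom =
        dominating D p (suc q) Out le₁ (≼-Unique Out≼L u)
          (λ i∈ j∈ → tot (there (≼-∈ Out≼L i∈)) (there (≼-∈ Out≼L j∈)))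
      rest′ , IJ≼L = ≼-trans (rest , IJ≼) Out≼L
  in v ∷ I , J , cong suc |I| , |J| , (rest′ , prep v IJ≼L) , λ where
       (here refl) j∈ → All.lookup out (≼-∈ (rest , IJ≼) (∈-++⁺ʳ I j∈))
       (there i∈)  j∈ → dom i∈ j∈
... | inj₂ le₂ =
  let In≼L = Out , ↭-trans perm (++-comm Out In)
      I , J , |I| , |J| , (rest , IJ≼) , dom =
        dominating D (suc p) q In le₂ (≼-Unique In≼L u)
          (λ i∈ j∈ → tot (there (≼-∈ In≼L i∈)) (there (≼-∈ In≼L j∈)))
      rest′ , IJ≼L = ≼-trans (rest , IJ≼) In≼L
  in I , v ∷ J , |I| , cong suc |J| ,
     (rest′ , ↭-trans (prep v IJ≼L) (↭-sym (++⁺ʳ rest′ (shift v I J)))) , λ where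
       i∈ (here refl) → All.lookup in′ (≼-∈ (rest , IJ≼) (∈-++⁺ˡ i∈))
       i∈ (there j∈)  → dom i∈ j∈

-- Covering a given part by a biclique

choose : ∀ (f : B → A) {Q : B → Set} L → (∀ {i} → i ∈ L → ∃[ v ] f v ≡ i × Q v) →
  ∃[ vs ] map f vs ≡ L × All Q vs
choose f []      h = [] , refl , []
choose f (i ∷ L) h =
  let v , fv≡i , Qv = h (here refl)
      vs , fvs≡L , Qvs = choose f L (h ∘ there)
  in v ∷ vs , cong₂ _∷_ fv≡i fvs≡L , Qv ∷ Qvs

-- The factor `E` pays for keeping only the parts in which a vertex x is rich. Across a dominating
-- pair the paths from x have density at least 1 / (2E) = 2 / (4E), so `dense-biclique` runs with
-- denominator 4E. Its size conditions then carry the factor 2 (4E)², which is `D` here.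
coverBound : ℕ → ℕ → ℕ
coverBound E n = E * ramsey p (D * (n * 2 ^ p))
  where
  D = 2 * (2 * (2 * E) * (2 * (2 * E)))
  p = D * n

module Parts {I V : Set} (class : V → I) (P : I → List V)
  (∈P⇒class : ∀ {i v} → v ∈ P i → class v ≡ i)
  (P-nonZero : ∀ i → NonZero (length (P i))) where

  size : I → ℕ
  size i = length (P i)

  between : (V → V → Bool) → I → I → ℕ
  between R i j = ∑ (P i) (λ y → # (R y) (P j))

  rich : (V → V → Bool) → ℕ → ℕ → V → I → Bool
  rich R c D y j = c * size j ≤ᵇ D * # (R y) (P j)

  -- For each `j`, `markov` makes a 1 / D share of `P i` rich to `j`. Double counting the rich pairs
  -- (y, j), with each `j` counted once whatever its size, yields a single `y` rich to a 1 / D share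
  -- of `J`.
  popular : ∀ (R : V → V → Bool) c D i J →
    (∀ {j} → j ∈ J → suc c * (size j * size i) ≤ D * between R i j) →
    ∃[ y ] class y ≡ i ×
      length J ≤ D * # (rich R c D y) J
  popular R c D i J dense =
    let y , y∈ , le = average (P i) (λ y → D * # (rich R c D y) J) (λ _ → length J)
                        {{P-nonZero i}} (begin
          ∑ (P i) (λ _ → length J)                  ≡⟨ ∑-const (P i) _ ⟩
          length J * size i                         ≡⟨ *-comm (length J) _ ⟩
          size i * length J                         ≡⟨ ∑-const J (size i) ⟨
          ∑ J (λ _ → size i)                        ≤⟨ ∑-mono J (λ j∈ → step _ (dense j∈)) ⟩
          ∑ J (λ j → D * # (good j) (P i))          ≡⟨ ∑-* J D _ ⟩
          D * ∑ J (λ j → # (good j) (P i))          ≡⟨ cong (D *_) (∑-swap J (P i) _) ⟩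
          D * ∑ (P i) (λ y → # (λ j → good j y) J)  ≡⟨ ∑-* (P i) D _ ⟨
          ∑ (P i) (λ y → D * # (λ j → good j y) J)  ∎)
    in y , ∈P⇒class y∈ , le
    where
    open ≤-Reasoning
    good : I → V → Bool
    good j y = rich R c D y j

    step : ∀ j → suc c * (size j * size i) ≤ D * between R i j →
      size i ≤ D * # (good j) (P i)
    step j = markov (P i) (λ y → # (R y) (P j)) (size j) c D {{P-nonZero j}}
               (λ y → #≤length (R y) (P j))

  -- Reduction to one vertex per part. Each part of `K` first gets a vertex rich to a 1 / D share of
  -- `L`. Each part `j` of `L` then gets a vertex adjacent to at least 1 / D as many chosen vertices
  -- as are rich to `j`. The chosen vertices span density at least 1 / D², which is 2 / (2D²) as
  -- `kővári-sós-turán` asks.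
  dense-biclique : ∀ (R : V → V → Bool) n D K L → .{{NonZero n}} → .{{NonZero D}} →
    2 * (D * D) * n ≤ length K →
    2 * (D * D) * (n * 2 ^ length K) ≤ length L →
    (∀ {i j} → i ∈ K → j ∈ L → 2 * (size j * size i) ≤ D * between R i j) →
    ∃[ ys ] ∃[ zs ] map class ys ≼ K × map class zs ≼ L × length ys ≡ n ×
      length zs ≡ n × (∀ {y z} → y ∈ ys → z ∈ zs → T (R y z))
  dense-biclique R n D K L |K|≥ |L|≥ dense
    with choose class {Q = λ y → length L ≤ D * # (rich R 1 D y) L} K
           (λ i∈ → popular R 1 D _ L (dense i∈))
  ... | Y , refl , Y-popular
    with choose class
           {Q = λ z → # (λ y → rich R 1 D y (class z)) Y
                      ≤ D * # (λ y → R y z) Y} L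
           (λ {j} _ →
             let z , z∈ , le = average (P j) (λ z → D * # (λ y → R y z) Y)
                   (λ _ → # (λ y → rich R 1 D y j) Y) {{P-nonZero j}}
                   (neighbours j)
             in z , ∈P⇒class z∈ , subst (λ k → # (λ y → rich R 1 D y k) Y ≤ D * # (λ y → R y z) Y)
                                    (sym (∈P⇒class z∈)) le)
    where
    open ≤-Reasoning
    good : I → V → Bool
    good j y = rich R 1 D y j

    pointwise : ∀ j y → size j * 𝟙 (good j y) ≤ D * # (R y) (P j)
    pointwise j y with good j y in eq
    ... | true  = subst (_≤ D * # (R y) (P j)) (*-comm 1 (size j))
                    (≤ᵇ⇒≤ _ _ (subst T (sym eq) _))
    ... | false = subst (_≤ D * # (R y) (P j)) (sym (*-zeroʳ (size j))) z≤n

    neighbours : ∀ j → ∑ (P j) (λ _ → # (good j) Y) ≤ ∑ (P j) (λ z → D * # (λ y → R y z) Y)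
    neighbours j = begin
      ∑ (P j) (λ _ → # (good j) Y)              ≡⟨ ∑-const (P j) _ ⟩
      # (good j) Y * size j                     ≡⟨ *-comm _ (size j) ⟩
      size j * # (good j) Y                     ≡⟨ ∑-* Y (size j) _ ⟨
      ∑ Y (λ y → size j * 𝟙 (good j y))         ≤⟨ ∑-mono Y (λ {y} _ → pointwise j y) ⟩
      ∑ Y (λ y → D * # (R y) (P j))             ≡⟨ ∑-* Y D _ ⟩
      D * ∑ Y (λ y → # (R y) (P j))             ≡⟨ cong (D *_) (∑-swap Y (P j) _) ⟩
      D * ∑ (P j) (λ z → # (λ y → R y z) Y)     ≡⟨ ∑-* (P j) D _ ⟨
      ∑ (P j) (λ z → D * # (λ y → R y z) Y)     ∎
  ... | Z , refl , Z-popular =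
    let ys , zs , ys≼ , zs≼ , |ys| , |zs| , complete =
          kővári-sós-turán R n (2 * (D * D)) Y Z
            (subst (2 * (D * D) * n ≤_) (length-map class Y) |K|≥)
            (subst₂ (λ k l → 2 * (D * D) * (n * 2 ^ k) ≤ l)
              (length-map class Y) (length-map class Z) |L|≥)
            dense-YZ
    in ys , zs , ≼-map class ys≼ , ≼-map class zs≼ , |ys| , |zs| , complete
    where
    open ≤-Reasoning
    open +-*-Solver
    instance
      D²-nonZero : NonZero (D * D)
      D²-nonZero = m*n≢0 D D
      2D²-nonZero : NonZero (2 * (D * D))
      2D²-nonZero = m*n≢0 2 (D * D)

    good : I → V → Bool
    good j y = rich R 1 D y j

    dense-YZ : 2 * (length Y * length Z) ≤ 2 * (D * D) * ∑ Z (λ z → # (λ y → R y z) Y)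
    dense-YZ = begin
      2 * (length Y * length Z)
        ≡⟨ cong (λ k → 2 * (length Y * k)) (length-map class Z) ⟨
      2 * (length Y * length L)
        ≡⟨ cong (2 *_) (*-comm (length Y) _) ⟩
      2 * (length L * length Y)
        ≡⟨ cong (2 *_) (∑-const Y (length L)) ⟨
      2 * ∑ Y (λ _ → length L)
        ≤⟨ *-monoʳ-≤ 2 (∑-mono Y (All.lookup Y-popular)) ⟩
      2 * ∑ Y (λ y → D * # (λ j → good j y) L)
        ≡⟨ cong (2 *_) (∑-* Y D _) ⟩
      2 * (D * ∑ Y (λ y → # (λ j → good j y) L))
        ≡⟨ cong (λ k → 2 * (D * k)) (∑-swap Y L _) ⟩
      2 * (D * ∑ L (λ j → # (good j) Y))
        ≡⟨ cong (λ k → 2 * (D * k)) (∑-map class Z _) ⟩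
      2 * (D * ∑ Z (λ z → # (good (class z)) Y))
        ≤⟨ *-monoʳ-≤ 2 (*-monoʳ-≤ D (∑-mono Z (All.lookup Z-popular))) ⟩
      2 * (D * ∑ Z (λ z → D * # (λ y → R y z) Y))
        ≡⟨ cong (λ k → 2 * (D * k)) (∑-* Z D _) ⟩
      2 * (D * (D * ∑ Z (λ z → # (λ y → R y z) Y)))
        ≡⟨ solve 2 (λ d s → con 2 :* (d :* (d :* s)) := con 2 :* (d :* d) :* s) refl D _ ⟩
      2 * (D * D) * ∑ Z (λ z → # (λ y → R y z) Y)
        ∎

  -- With E = c + b, `b²≤` says that (1 - c / E)² is at most c / E, and `dense` that all densities
  -- are at least (c + 1) / E. The surplus 1 / E is spent once on `markov`, when x is chosen, and
  -- once on finding paths from x.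
  module Cover (adj : V → V → Bool) (adj-sym : ∀ u v → adj u v ≡ adj v u)
    (c b : ℕ) .{{_ : NonZero (c + b)}} (b²≤ : b * b ≤ c * (c + b))
    (dense : ∀ {i j} → i ≢ j → suc c * (size j * size i) ≤ (c + b) * between adj i j)
    where

    E = c + b

    cherry : V → V → V → Bool
    cherry x y z = adj x y ∧ adj y z

    far : V → I → ℕ
    far x i = # (not ∘ adj x) (P i)

    far-bound : ∀ x i → T (rich adj c E x i) → E * far x i ≤ b * size i
    far-bound x i r = +-cancelˡ-≤ (c * size i) _ _ (begin
      c * size i + E * far x i               ≤⟨ +-monoˡ-≤ _ (≤ᵇ⇒≤ (c * size i) (E * # (adj x) (P i)) r) ⟩
      E * # (adj x) (P i) + E * far x i      ≡⟨ *-distribˡ-+ E (# (adj x) (P i)) _ ⟨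
      E * (# (adj x) (P i) + far x i)        ≡⟨ cong (E *_) (∑-+ (P i) _ _) ⟨
      E * ∑ (P i) (λ y → 𝟙 (adj x y) + 𝟙 (not (adj x y)))
                                             ≡⟨ cong (E *_) (∑-cong (P i) (λ y → total (adj x y))) ⟩
      E * ∑ (P i) (λ _ → 1)                  ≡⟨ cong (E *_) (trans (∑-const (P i) 1) (*-identityˡ _)) ⟩
      E * size i                             ≡⟨ *-distribʳ-+ (size i) c b ⟩
      c * size i + b * size i                ∎)
      where
      open ≤-Reasoning
      total : ∀ a → 𝟙 a + 𝟙 (not a) ≡ 1
      total true  = refl
      total false = refl

    -- An edge y z is reached from `x` through y, or through z, or has both ends outside the
    -- neighbourhood of `x`. The last kind is bounded by all such pairs, adjacent or not.
    between-bound : ∀ x i j →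
      between adj i j ≤ between (cherry x) i j + between (cherry x) j i + far x i * far x j
    between-bound x i j = begin
      ∑ (P i) (λ y → ∑ (P j) (λ z → 𝟙 (adj y z)))
        ≤⟨ ∑-mono (P i) (λ {y} _ → ∑-mono (P j) (λ {z} _ → pointwise y z)) ⟩
      ∑ (P i) (λ y → ∑ (P j) (λ z → f y z + g y z + h y z))
        ≡⟨ ∑-cong (P i) (λ y → trans (∑-+ (P j) (λ z → f y z + g y z) (h y))
                                     (cong (_+ ∑ (P j) (h y)) (∑-+ (P j) (f y) (g y)))) ⟩
      ∑ (P i) (λ y → ∑ (P j) (f y) + ∑ (P j) (g y) + ∑ (P j) (h y))
        ≡⟨ trans (∑-+ (P i) (λ y → ∑ (P j) (f y) + ∑ (P j) (g y)) _)
                 (cong (_+ ∑ (P i) (λ y → ∑ (P j) (h y))) (∑-+ (P i) (λ y → ∑ (P j) (f y)) _)) ⟩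
      between (cherry x) i j + ∑ (P i) (λ y → ∑ (P j) (g y)) + ∑ (P i) (λ y → ∑ (P j) (h y))
        ≡⟨ cong₂ (λ k l → between (cherry x) i j + k + l) (∑-swap (P i) (P j) g) ∑h ⟩
      between (cherry x) i j + between (cherry x) j i + far x i * far x j
        ∎
      where
      open ≤-Reasoning
      f g h : V → V → ℕ
      f y z = 𝟙 (cherry x y z)
      g y z = 𝟙 (cherry x z y)
      h y z = 𝟙 (not (adj x y)) * 𝟙 (not (adj x z))

      pointwise : ∀ y z → 𝟙 (adj y z) ≤ f y z + g y z + h y z
      pointwise y z rewrite adj-sym z y with adj x y | adj x z | adj y z
      ... | true  | _     | true  = s≤s z≤n
      ... | true  | _     | false = z≤n
      ... | false | true  | true  = s≤s z≤n
      ... | false | true  | false = z≤n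
      ... | false | false | true  = s≤s z≤n
      ... | false | false | false = z≤n

      ∑h : ∑ (P i) (λ y → ∑ (P j) (h y)) ≡ far x i * far x j
      ∑h = trans (∑-cong (P i) (λ y → trans (∑-* (P j) (𝟙 (not (adj x y))) _)
                                            (*-comm _ (far x j))))
                 (trans (∑-* (P i) (far x j) _) (*-comm (far x j) _))

    -- If neither direction were dense, nearly all edges between P i and P j would
    -- avoid the neighbours of x, which leaves density at most (b / E)² ≤ c / E.
    Dominates : V → I → I → Set
    Dominates x i j = size j * size i ≤ 2 * E * between (cherry x) i j

    dominates-total : ∀ {x i j} → i ≢ j → T (rich adj c E x i) → T (rich adj c E x j) →
      Dominates x i j ⊎ Dominates x j i
    dominates-total {x} {i} {j} i≢j ri rj =
      -- The paths in the two directions together have density at least 1 / E, so one direction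
      -- reaches the 1 / (2E) of `Dominates`.
      half (subst₂ _≤_
        (solve 2 (λ s t → con 2 :* (s :* t) := s :* t :+ t :* s) refl (size j) (size i))
        (solve 3 (λ e f g → con 2 :* (e :* (f :+ g)) := con 2 :* e :* f :+ con 2 :* e :* g) refl
           E (between (cherry x) i j) (between (cherry x) j i))
        (*-monoʳ-≤ 2 (+-cancelʳ-≤ (c * n²) _ _ (begin
          n² + c * n²
            ≤⟨ dense i≢j ⟩
          E * between adj i j
            ≤⟨ *-monoʳ-≤ E (between-bound x i j) ⟩
          E * (cherries + far x i * far x j)
            ≡⟨ *-distribˡ-+ E cherries _ ⟩
          E * cherries + E * (far x i * far x j)
            ≤⟨ +-monoʳ-≤ (E * cherries) far² ⟩
          E * cherries + c * n²
            ∎))))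
      where
      open ≤-Reasoning
      open +-*-Solver
      n² = size j * size i
      cherries = between (cherry x) i j + between (cherry x) j i

      far² : E * (far x i * far x j) ≤ c * n²
      far² = *-cancelˡ-≤ E (begin
        E * (E * (far x i * far x j))
          ≡⟨ solve 3 (λ e f g → e :* (e :* (f :* g)) := (e :* f) :* (e :* g)) refl E (far x i) (far x j) ⟩
        E * far x i * (E * far x j)
          ≤⟨ *-mono-≤ (far-bound x i ri) (far-bound x j rj) ⟩
        b * size i * (b * size j)
          ≡⟨ solve 3 (λ b s t → b :* s :* (b :* t) := b :* b :* (t :* s)) refl b (size i) (size j) ⟩
        b * b * n²
          ≤⟨ *-monoˡ-≤ n² b²≤ ⟩
        c * E * n²
          ≡⟨ solve 3 (λ c e s → c :* e :* s := e :* (c :* s)) refl c E n² ⟩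
        E * (c * n²)
          ∎)

    -- The biclique is sought for the relation `cherry x` in place of `adj`. It then joins `ys` to
    -- `zs` and in the same move `x` to `ys`, so that `x` can stand on the side of `zs`.
    cover : ∀ n → .{{NonZero n}} → ∀ l L → coverBound E n ≤ length L → Unique (l ∷ L) →
      ∃[ x ] ∃[ ys ] ∃[ zs ] class x ≡ l × length ys ≡ n × length zs ≡ n ×
        map class ys ++ map class zs ≼ L ×
        (∀ {y} → y ∈ ys → T (adj x y)) ×
        (∀ {y z} → y ∈ ys → z ∈ zs → T (adj y z))
    cover n l L |L|≥ u@(l∉L ∷ uL) =
      let x , class-x , le = popular adj c E l L (λ j∈ → dense (All.lookup l∉L j∈))
          L′ , L′≼L , rich-L′ , |L′| = select (rich adj c E x) L
          I , J , |I| , |J| , IJ≼L′ , dom =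
            dominating (Dominates x) p q L′
              (*-cancelˡ-≤ E (≤-trans |L|≥ (subst (λ k → length L ≤ E * k) (sym |L′|) le)))
              (≼-Unique L′≼L uL)
              (λ i∈ j∈ i≢j → dominates-total i≢j (All.lookup rich-L′ i∈) (All.lookup rich-L′ j∈))
          ys , zs , ys≼ , zs≼ , |ys| , |zs| , complete =
            dense-biclique (cherry x) n (2 * (2 * E)) I J
              (≤-reflexive (sym |I|))
              (≤-reflexive (trans (cong (λ k → D * (n * 2 ^ k)) |I|) (sym |J|)))
              (λ {i} {j} i∈ j∈ → subst (2 * (size j * size i) ≤_)
                (sym (*-assoc 2 (2 * E) (between (cherry x) i j))) (*-monoʳ-≤ 2 (dom i∈ j∈)))
          z₀ , z₀∈ = inhabited zs |zs|
      in x , ys , zs , class-x , |ys| , |zs| ,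
         ≼-trans (≼-++ ys≼ zs≼) (≼-trans IJ≼L′ L′≼L) ,
         -- A cherry through `y` needs an end point; any member of `zs` will do.
         (λ y∈ → proj₁ (Equivalence.to T-∧ (complete y∈ z₀∈))) ,
         (λ {y} {z} y∈ z∈ → proj₂ (Equivalence.to (T-∧ {adj x y}) (complete y∈ z∈)))
      where
      D = 2 * (2 * (2 * E) * (2 * (2 * E)))
      p = D * n
      q = D * (n * 2 ^ p)

      instance
        2E-nonZero : NonZero (2 * E)
        2E-nonZero = m*n≢0 2 E
        4E-nonZero : NonZero (2 * (2 * E))
        4E-nonZero = m*n≢0 2 (2 * E)

      inhabited : ∀ vs → length vs ≡ n → ∃[ v ] v ∈ vs
      inhabited (v ∷ vs) _  = v , here refl
      inhabited []       eq = ⊥-elim (<⇒≢ (>-nonZero⁻¹ n) eq)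

-- Tilings

count : ∀ {t} → (Fin t → Bool) → ℕ
count c = # id (tabulate c)

count-not : ∀ {t} (c : Fin t → Bool) → count c + count (not ∘ c) ≡ t
count-not {zero}  c = refl
count-not {suc t} c with c zero
... | true  = cong suc (count-not (c ∘ suc))
... | false = trans (+-suc _ _) (cong suc (count-not (c ∘ suc)))

count-nonZero : ∀ {t} (c : Fin t → Bool) u → c u ≡ true → ∃[ k ] count c ≡ suc k
count-nonZero c zero    eq rewrite eq = _ , refl
count-nonZero c (suc u) eq with c zero | count-nonZero (c ∘ suc) u eq
... | true  | _ = _ , refl
... | false | p = p

place : ∀ {t} (c : Fin t → Bool) (ys zs : List A) →
  length ys ≡ count c → length zs ≡ count (not ∘ c) →
  ∃[ f ] (∀ u → f u ∈ (if c u then ys else zs)) × tabulate f ↭ ys ++ zs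
place {t = zero}  c []       []       |ys| |zs| = (λ ()) , (λ ()) , ↭-refl
place {t = suc t} c ys       zs       |ys| |zs| with c zero in eq
place {t = suc t} c (y ∷ ys) zs |ys| |zs| | true =
  let f , f∈ , p = place (c ∘ suc) ys zs (suc-injective |ys|) |zs|
      g = λ { zero → y ; (suc u) → f u }
      g∈ : ∀ u → g u ∈ (if c u then y ∷ ys else zs)
      g∈ = λ where
        zero    → subst (λ b → y ∈ (if b then y ∷ ys else zs)) (sym eq) (here refl)
        (suc u) → weaken (c (suc u)) (f∈ u)
  in g , g∈ , prep y p
  where
  weaken : ∀ b {x} → x ∈ (if b then ys else zs) → x ∈ (if b then y ∷ ys else zs)
  weaken true  = there
  weaken false = id
place {t = suc t} c ys (z ∷ zs) |ys| |zs| | false =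
  let f , f∈ , p = place (c ∘ suc) ys zs |ys| (suc-injective |zs|)
      g = λ { zero → z ; (suc u) → f u }
      g∈ : ∀ u → g u ∈ (if c u then ys else z ∷ zs)
      g∈ = λ where
        zero    → subst (λ b → z ∈ (if b then ys else z ∷ zs)) (sym eq) (here refl)
        (suc u) → weaken (c (suc u)) (f∈ u)
  in g , g∈ , ↭-trans (prep z p) (↭-sym (shift z ys zs))
  where
  weaken : ∀ b {x} → x ∈ (if b then ys else zs) → x ∈ (if b then ys else z ∷ zs)
  weaken true  = id
  weaken false = there

split-length : ∀ a b m (xs : List A) → length xs ≡ a + b + m →
  ∃[ us ] ∃[ vs ] ∃[ ws ] xs ≡ us ++ vs ++ ws × length us ≡ a × length vs ≡ b × length ws ≡ m
split-length zero    zero    m xs       eq = [] , [] , xs , refl , refl , refl , eq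
split-length zero    (suc b) m (x ∷ xs) eq =
  let us , vs , ws , p , |us| , |vs| , |ws| = split-length′ b m xs (suc-injective eq)
  in us , x ∷ vs , ws , p , |us| , cong suc |vs| , |ws|
  where
  split-length′ : ∀ b m xs → length xs ≡ b + m →
    ∃[ us ] ∃[ vs ] ∃[ ws ] x ∷ xs ≡ us ++ (x ∷ vs) ++ ws × length us ≡ 0 × length vs ≡ b × length ws ≡ m
  split-length′ zero    m xs       eq = [] , [] , xs , refl , refl , refl , eq
  split-length′ (suc b) m (y ∷ xs) eq with split-length zero (suc b) m (y ∷ xs) eq
  ... | [] , vs , ws , p , |us| , |vs| , |ws| = [] , vs , ws , cong (x ∷_) p , refl , |vs| , |ws|
split-length (suc a) b m (x ∷ xs) eq =
  let us , vs , ws , p , |us| , |vs| , |ws| = split-length a b m xs (suc-injective eq)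
  in x ∷ us , vs , ws , cong (x ∷_) p , cong suc |us| , |vs| , |ws|

map-≡-++ : ∀ (f : A → B) xs {us vs} → us ++ vs ≡ map f xs →
  ∃[ ys ] us ≡ map f ys × ys ≼ xs
map-≡-++ f xs       {[]}     eq = [] , refl , (xs , ↭-refl)
map-≡-++ f (x ∷ xs) {u ∷ us} eq with ∷-injective eq
... | refl , eq′ =
  let ys , p , (rest , q) = map-≡-++ f xs eq′
  in x ∷ ys , cong (f x ∷_) p , (rest , prep x q)

≼-map-inv : ∀ (f : A → B) {us xs} → us ≼ map f xs → ∃[ ys ] us ≡ map f ys × ys ≼ xs
≼-map-inv f (vs , p) =
  let xs′ , eq , xs↭ = ↭-map-inv f p
      ys , us≡ , (ws , q) = map-≡-++ f xs′ eq
  in ys , us≡ , (ws , ↭-trans xs↭ q)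

-- The first summand is room for finding the reserve. The others count parts in units of `t`: `h`
-- for each side of the reserve and `k` for the remainder of the greedy tiling. Covering that
-- remainder costs one side k t (t - 1) parts, the other side gives up as many, and h t = k t² + k t
-- leaves 2 k t on each. As `k` exceeds `coverBound t`, the greedy steps never run short.
tilingBound : ℕ → (ℕ → ℕ) → ℕ
tilingBound t coverBound = suc (coverBound (h * t)) + (h + h + k)
  where
  k = suc (coverBound t)
  h = k * t + k

module Tiling {I V : Set} (adj : V → V → Bool) (adj-sym : ∀ u v → adj u v ≡ adj v u)
  (class : V → I) {t′ : ℕ} (F : Graph (suc t′))
  (colour : Fin (suc t′) → Bool) (proper : ∀ u v → Adj F u v → colour u ≢ colour v)
  where

  t : ℕ
  t = suc t′

  -- A homomorphism suffices: in a tiling of a list without repetitions the vertices of a tile lie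
  -- in distinct parts, and injectivity follows from that.
  record Tile : Set where
    field
      vertex : Fin t → V
      hom    : ∀ u v → Adj F u v → T (adj (vertex u) (vertex v))

    parts : List I
    parts = map class (tabulate vertex)

    length-parts : length parts ≡ t
    length-parts = trans (length-map class (tabulate vertex)) (length-tabulate vertex)

  open Tile

  infixr 5 _∷⟨_⟩_
  data Tileable : ℕ → List I → Set where
    []     : Tileable 0 []
    _∷⟨_⟩_ : ∀ {r K L} (f : Tile) → K ↭ parts f ++ L → Tileable r L → Tileable (suc r) K

  Tileable-length : ∀ {r L} → Tileable r L → length L ≡ r * t
  Tileable-length []              = refl
  Tileable-length (f ∷⟨ p ⟩ tiles) = trans (↭-length p) (trans (length-++ (parts f))
    (cong₂ _+_ (length-parts f) (Tileable-length tiles)))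

  Tileable-↭ : ∀ {r K L} → K ↭ L → Tileable r L → Tileable r K
  Tileable-↭ p [] with refl ← ↭-empty-inv p = []
  Tileable-↭ p (f ∷⟨ q ⟩ tiles) = f ∷⟨ ↭-trans p q ⟩ tiles

  Tileable-++ : ∀ {r s K L} → Tileable r K → Tileable s L → Tileable (r + s) (K ++ L)
  Tileable-++ []                        tilesL = tilesL
  Tileable-++ {L = L} (f ∷⟨ p ⟩ tilesK) tilesL =
    f ∷⟨ ↭-trans (++⁺ʳ L p) (↭-reflexive (++-assoc (parts f) _ L)) ⟩ Tileable-++ tilesK tilesL

  a b : ℕ
  a = count colour
  b = count (not ∘ colour)

  bipartite-tile : ∀ ys zs → length ys ≡ a → length zs ≡ b →
    (∀ {y z} → y ∈ ys → z ∈ zs → T (adj y z)) →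
    ∃[ f ] parts f ↭ map class ys ++ map class zs
  bipartite-tile ys zs |ys| |zs| complete =
    let f , f∈ , p = place colour ys zs |ys| |zs|
    in record { vertex = f ; hom = λ u v uv → edge (f∈ u) (f∈ v) (proper u v uv) } ,
       ↭-trans (map⁺ class p) (↭-reflexive (map-++ class ys zs))
    where
    edge : ∀ {c d x y} → x ∈ (if c then ys else zs) → y ∈ (if d then ys else zs) →
      c ≢ d → T (adj x y)
    edge {true}  {true}  x∈ y∈ c≢d = ⊥-elim (c≢d refl)
    edge {true}  {false} x∈ y∈ c≢d = complete x∈ y∈
    edge {false} {true}  x∈ y∈ c≢d = subst T (adj-sym _ _) (complete y∈ x∈)
    edge {false} {false} x∈ y∈ c≢d = ⊥-elim (c≢d refl)

  -- Two tiles with opposite orientations take `a + b`, that is `t`, from each side, so equal sides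
  -- stay equal however unbalanced the colouring is.
  biclique-tileable : ∀ k ys zs → length ys ≡ k * t → length zs ≡ k * t →
    (∀ {y z} → y ∈ ys → z ∈ zs → T (adj y z)) →
    Tileable (k * 2) (map class ys ++ map class zs)
  biclique-tileable zero    [] [] |ys| |zs| complete = []
  biclique-tileable (suc k) ys zs |ys| |zs| complete
    with split-length a b (k * t) ys (trans |ys| (cong (_+ k * t) (sym (count-not colour))))
       | split-length a b (k * t) zs (trans |zs| (cong (_+ k * t) (sym (count-not colour))))
  ... | us , vs , ws , refl , |us| , |vs| , |ws| | us′ , vs′ , ws′ , refl , |us′| , |vs′| , |ws′| =
    let f , p = bipartite-tile us vs′ |us| |vs′|
                  (λ y∈ z∈ → complete (∈-++⁺ˡ y∈) (∈-++⁺ʳ us′ (∈-++⁺ˡ z∈)))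
        g , q = bipartite-tile us′ vs |us′| |vs|
                  (λ {y} {z} y∈ z∈ → subst T (adj-sym z y)
                    (complete (∈-++⁺ʳ us (∈-++⁺ˡ z∈)) (∈-++⁺ˡ y∈)))
        tiles = biclique-tileable k ws ws′ |ws| |ws′|
                  (λ y∈ z∈ → complete (∈-++⁺ʳ us (∈-++⁺ʳ vs y∈)) (∈-++⁺ʳ us′ (∈-++⁺ʳ vs′ z∈)))
    in f ∷⟨ regroup f g p q ⟩ (g ∷⟨ ↭-refl ⟩ tiles)
    where
    open PermutationReasoning
    ⟦_⟧ = map class
    ⟦++++⟧ : ∀ us vs ws → ⟦ us ++ vs ++ ws ⟧ ≡ ⟦ us ⟧ ++ ⟦ vs ⟧ ++ ⟦ ws ⟧
    ⟦++++⟧ us vs ws = trans (map-++ class us (vs ++ ws)) (cong (⟦ us ⟧ ++_) (map-++ class vs ws))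

    shuffle : ∀ us vs ws us′ vs′ ws′ → (us ++ vs ++ ws) ++ us′ ++ vs′ ++ ws′ ↭
      (us ++ vs′) ++ (us′ ++ vs) ++ ws ++ ws′
    shuffle = solve 6 (λ us vs ws us′ vs′ ws′ →
      (us ⊕ (vs ⊕ ws)) ⊕ (us′ ⊕ (vs′ ⊕ ws′)) ⊜ (us ⊕ vs′) ⊕ ((us′ ⊕ vs) ⊕ (ws ⊕ ws′))) ↭-refl
      where open MonoidSolver (++-commutativeMonoid {A = I})

    regroup : ∀ f g → parts f ↭ ⟦ us ⟧ ++ ⟦ vs′ ⟧ → parts g ↭ ⟦ us′ ⟧ ++ ⟦ vs ⟧ →
      ⟦ us ++ vs ++ ws ⟧ ++ ⟦ us′ ++ vs′ ++ ws′ ⟧ ↭ parts f ++ parts g ++ ⟦ ws ⟧ ++ ⟦ ws′ ⟧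
    regroup f g p q = begin
      ⟦ us ++ vs ++ ws ⟧ ++ ⟦ us′ ++ vs′ ++ ws′ ⟧
        ≡⟨ cong₂ _++_ (⟦++++⟧ us vs ws) (⟦++++⟧ us′ vs′ ws′) ⟩
      (⟦ us ⟧ ++ ⟦ vs ⟧ ++ ⟦ ws ⟧) ++ ⟦ us′ ⟧ ++ ⟦ vs′ ⟧ ++ ⟦ ws′ ⟧
        ↭⟨ shuffle ⟦ us ⟧ ⟦ vs ⟧ ⟦ ws ⟧ ⟦ us′ ⟧ ⟦ vs′ ⟧ ⟦ ws′ ⟧ ⟩
      (⟦ us ⟧ ++ ⟦ vs′ ⟧) ++ (⟦ us′ ⟧ ++ ⟦ vs ⟧) ++ ⟦ ws ⟧ ++ ⟦ ws′ ⟧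
        ↭⟨ ++⁺ (↭-sym p) (++⁺ʳ _ (↭-sym q)) ⟩
      parts f ++ parts g ++ ⟦ ws ⟧ ++ ⟦ ws′ ⟧
        ∎

  -- False is the colour of the side of `zs`, which the vertex covering a prescribed part is to
  -- join; `w` guarantees that a tile has a place there.
  module Covering (w : Fin t) (w-false : colour w ≡ false) (coverBound : ℕ → ℕ)
    (cover : ∀ n → .{{NonZero n}} → ∀ l L → coverBound n ≤ length L → Unique (l ∷ L) →
      ∃[ x ] ∃[ ys ] ∃[ zs ] class x ≡ l × length ys ≡ n × length zs ≡ n ×
        map class ys ++ map class zs ≼ L ×
        (∀ {y} → y ∈ ys → T (adj x y)) ×
        (∀ {y z} → y ∈ ys → z ∈ zs → T (adj y z)))
    where

    M : ℕ
    M = coverBound t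

    a≤t : a ≤ t
    a≤t = subst (a ≤_) (count-not colour) (m≤m+n a b)

    b≤t : b ≤ t
    b≤t = subst (b ≤_) (count-not colour) (m≤n+m b a)

    -- Like the vertices of `zs`, `x` is adjacent to all of `ys`. So it takes one of the `b` places
    -- on their side, and `b′` vertices of `zs` fill the others.
    cover-tile : ∀ l L → M ≤ length L → Unique (l ∷ L) →
      ∃[ f ] ∃[ L′ ] l ∷ L ↭ parts f ++ L′ × L′ ≼ L × length L′ + t ≡ suc (length L)
    cover-tile l L |L|≥ u
      with cover t l L |L|≥ u | count-nonZero (not ∘ colour) w (cong not w-false)
    ... | x , ys , zs , refl , |ys| , |zs| , ≼L , x~ , complete | b′ , b≡
      with ≼-trans (≼-++ (≼-map class (take-≼ a ys)) (≼-map class (take-≼ b′ zs))) ≼L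
    ... | L′ , p =
      let f , q = bipartite-tile (take a ys) (x ∷ take b′ zs)
            (length-take-≤ a ys (subst (a ≤_) (sym |ys|) a≤t))
            (trans (cong suc (length-take-≤ b′ zs
                     (subst (b′ ≤_) (sym |zs|) (≤-trans (n≤1+n b′) (subst (_≤ t) b≡ b≤t)))))
                   (sym b≡))
            λ where
              y∈ (here refl) → subst T (adj-sym x _) (x~ (≼-∈ (take-≼ a ys) y∈))
              y∈ (there z∈)  → complete (≼-∈ (take-≼ a ys) y∈) (≼-∈ (take-≼ b′ zs) z∈)
          r = begin
            class x ∷ L
              ↭⟨ prep (class x) (↭-trans p (↭-reflexive (++-assoc ys↓ zs↓ L′))) ⟩
            class x ∷ ys↓ ++ zs↓ ++ L′
              ↭⟨ shift (class x) ys↓ (zs↓ ++ L′) ⟨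
            ys↓ ++ class x ∷ zs↓ ++ L′
              ≡⟨ ++-assoc ys↓ (class x ∷ zs↓) L′ ⟨
            (ys↓ ++ class x ∷ zs↓) ++ L′
              ↭⟨ ++⁺ʳ L′ q ⟨
            parts f ++ L′
              ∎
      in f , L′ , r , (ys↓ ++ zs↓ , ↭-trans p (++-comm (ys↓ ++ zs↓) L′)) ,
         trans (+-comm (length L′) t)
           (trans (cong (_+ length L′) (sym (length-parts f)))
             (trans (sym (length-++ (parts f))) (sym (↭-length r))))
      where
      open PermutationReasoning
      ys↓ = map class (take a ys)
      zs↓ = map class (take b′ zs)

    -- Greedy: each step covers the first part of the list. `suc M` accounts for that part and for
    -- the `M` others that `cover-tile` needs beside it.
    peel : ∀ j L → suc M + j * t ≤ length L → Unique L →
      ∃[ K ] ∃[ L′ ] L ↭ K ++ L′ × Tileable j K × length L′ + j * t ≡ length L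
    peel zero    L       |L|≥ u = [] , L , ↭-refl , [] , +-identityʳ (length L)
    peel (suc j) (l ∷ L) |L|≥ u =
      let f , L₁ , p , _ , |L₁| = cover-tile l L (≤-trans (m≤m+n M _) (≤-pred |L|≥)) u
          K , L′ , q , tiles , |L′| = peel j L₁
            (+-cancelʳ-≤ t (suc M + j * t) (length L₁) (let open ≤-Reasoning in begin
              suc M + j * t + t   ≡⟨ +-assoc (suc M) (j * t) t ⟩
              suc M + (j * t + t) ≡⟨ cong (λ s → suc M + s) (+-comm (j * t) t) ⟩
              suc M + suc j * t   ≤⟨ |L|≥ ⟩
              suc (length L)      ≡⟨ |L₁| ⟨
              length L₁ + t       ∎))
            (≼-Unique (parts f , ↭-trans p (++-comm (parts f) L₁)) u)
      in parts f ++ K , L′ ,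
         ↭-trans p (↭-trans (++⁺ˡ (parts f) q) (↭-reflexive (sym (++-assoc (parts f) K L′)))) ,
         f ∷⟨ ↭-refl ⟩ tiles ,
         (let open ≡-Reasoning in begin
            length L′ + (t + j * t)   ≡⟨ cong (λ s → length L′ + s) (+-comm t (j * t)) ⟩
            length L′ + (j * t + t)   ≡⟨ +-assoc (length L′) (j * t) t ⟨
            length L′ + j * t + t     ≡⟨ cong (_+ t) |L′| ⟩
            length L₁ + t             ≡⟨ |L₁| ⟩
            suc (length L)            ∎)

    -- The tile covering a part of `R` takes its other parts from `Q` alone, so no two parts of `R`
    -- share a tile and the total cost to `Q` is known exactly: t - 1 for each. The hypothesis
    -- allows t for each.
    cover-all : ∀ R Q → M + length R * t ≤ length Q → Unique (R ++ Q) →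
      ∃[ K ] ∃[ Q′ ] R ++ Q ↭ K ++ Q′ × Q′ ≼ Q × Tileable (length R) K
    cover-all []      Q |Q|≥ u = [] , Q , ↭-refl , ([] , ↭-reflexive (sym (++-identityʳ Q))) , []
    cover-all (l ∷ R) Q |Q|≥ u@(l∉ ∷ _) =
      let f , Q₁ , p , Q₁≼Q , |Q₁| = cover-tile l Q (≤-trans (m≤m+n M _) |Q|≥)
            (≼-Unique (R , prep l (++-comm R Q)) u)
          RQ₁≼ = ≼-trans (≼-++ {xs = R} {ys = Q₁} ≼-refl Q₁≼Q) (l ∷ [] , ++-comm (l ∷ []) (R ++ Q))
          K , Q′ , q , Q′≼Q₁ , tiles = cover-all R Q₁
            (+-cancelʳ-≤ t (M + length R * t) (length Q₁) (let open ≤-Reasoning in begin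
              M + length R * t + t   ≡⟨ +-assoc M (length R * t) t ⟩
              M + (length R * t + t) ≡⟨ cong (λ s → M + s) (+-comm (length R * t) t) ⟩
              M + suc (length R) * t ≤⟨ |Q|≥ ⟩
              length Q               ≤⟨ n≤1+n _ ⟩
              suc (length Q)         ≡⟨ |Q₁| ⟨
              length Q₁ + t          ∎))
            (≼-Unique RQ₁≼ u)
      in parts f ++ K , Q′ , perm R Q p q , ≼-trans Q′≼Q₁ Q₁≼Q , f ∷⟨ ↭-refl ⟩ tiles
      where
      ≼-refl : ∀ {xs : List I} → xs ≼ xs
      ≼-refl = [] , ↭-reflexive (sym (++-identityʳ _))

      perm : ∀ R Q {X Q₁ K Q′} → l ∷ Q ↭ X ++ Q₁ → R ++ Q₁ ↭ K ++ Q′ →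
        l ∷ R ++ Q ↭ (X ++ K) ++ Q′
      perm R Q {X} {Q₁} {K} {Q′} p q = let open PermutationReasoning in begin
        l ∷ R ++ Q      ↭⟨ shift l R Q ⟨
        R ++ l ∷ Q      ↭⟨ ++⁺ˡ R p ⟩
        R ++ X ++ Q₁    ↭⟨ shifts R X ⟩
        X ++ R ++ Q₁    ↭⟨ ++⁺ˡ X q ⟩
        X ++ K ++ Q′    ≡⟨ ++-assoc X K Q′ ⟨
        (X ++ K) ++ Q′  ∎

    k h N : ℕ
    k = suc M
    h = k * t + k
    N = h * t

    k≤k*t : k ≤ k * t
    k≤k*t = m≤m*n k t

    -- The parts of R are covered at the expense of zs, after which tiles inside
    -- ys restore the balance between the two sides of the biclique.
    absorb : ∀ ys zs R → length ys ≡ N → length zs ≡ N →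
      (∀ {y z} → y ∈ ys → z ∈ zs → T (adj y z)) → length R ≡ k * t →
      Unique (map class ys ++ map class zs ++ R) →
      ∃[ s ] Tileable s (map class ys ++ map class zs ++ R)
    absorb ys zs R |ys| |zs| complete |R| u
      with cover-all R (map class zs) room₂ (≼-Unique (map class ys , R-last) u)
         -- Covering `R` costs `zs` exactly k t (t - 1) parts; `k * t′` tiles of `t` parts inside
         -- `ys` cost as many there.
         | peel (k * t′) (map class ys) room₁ (≼-Unique (map class zs ++ R , ↭-refl) u)
      where
      open ≤-Reasoning
      open +-*-Solver

      R-last : map class ys ++ map class zs ++ R ↭ (R ++ map class zs) ++ map class ys
      R-last = ↭-trans (++-comm (map class ys) _) (++⁺ʳ (map class ys) (++-comm (map class zs) R))

      room₁ : suc M + k * t′ * t ≤ length (map class ys)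
      room₁ = begin
        k + k * t′ * t          ≤⟨ +-mono-≤ k≤k*t (*-monoˡ-≤ t (*-monoʳ-≤ k (n≤1+n t′))) ⟩
        k * t + k * t * t       ≡⟨ solve 2 (λ k t → k :* t :+ k :* t :* t := (k :* t :+ k) :* t) refl k t ⟩
        N                       ≡⟨ trans (length-map class ys) |ys| ⟨
        length (map class ys)   ∎

      room₂ : M + length R * t ≤ length (map class zs)
      room₂ = begin
        M + length R * t        ≡⟨ cong (λ r → M + r * t) |R| ⟩
        M + k * t * t           ≤⟨ +-monoˡ-≤ (k * t * t) (≤-trans (n≤1+n M) k≤k*t) ⟩
        k * t + k * t * t       ≡⟨ solve 2 (λ k t → k :* t :+ k :* t :* t := (k :* t :+ k) :* t) refl k t ⟩
        N                       ≡⟨ trans (length-map class zs) |zs| ⟨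
        length (map class zs)   ∎
    ... | K₂ , Q₂ , p₂ , Q₂≼ , tiles₂ | K₁ , Q₁ , p₁ , tiles₁ , |Q₁|+
      with ≼-map-inv class Q₂≼ | ≼-map-inv class {Q₁} {ys} (K₁ , ↭-trans p₁ (++-comm K₁ Q₁))
    ... | zs′ , refl , zs′≼zs | ys′ , refl , ys′≼ys =
      _ , Tileable-↭ perm (Tileable-++ tiles₁ (Tileable-++ tiles₂
            (biclique-tileable (k * 2) ys′ zs′ |ys′| |zs′|
              (λ y∈ z∈ → complete (≼-∈ ys′≼ys y∈) (≼-∈ zs′≼zs z∈)))))
      where
      open +-*-Solver
      perm : map class ys ++ map class zs ++ R ↭ K₁ ++ K₂ ++ map class ys′ ++ map class zs′
      perm = begin
        map class ys ++ map class zs ++ R                ↭⟨ ++⁺ p₁ (↭-trans (++-comm (map class zs) R) p₂) ⟩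
        (K₁ ++ map class ys′) ++ K₂ ++ map class zs′     ≡⟨ ++-assoc K₁ _ _ ⟩
        K₁ ++ map class ys′ ++ K₂ ++ map class zs′       ↭⟨ ++⁺ˡ K₁ (shifts (map class ys′) K₂) ⟩
        K₁ ++ K₂ ++ map class ys′ ++ map class zs′       ∎
        where open PermutationReasoning

      |ys′| : length ys′ ≡ k * 2 * t
      |ys′| = +-cancelʳ-≡ (k * t′ * t) _ _ (begin
        length ys′ + k * t′ * t               ≡⟨ cong (_+ k * t′ * t) (length-map class ys′) ⟨
        length (map class ys′) + k * t′ * t   ≡⟨ |Q₁|+ ⟩
        length (map class ys)                 ≡⟨ trans (length-map class ys) |ys| ⟩
        N                                     ≡⟨ solve 2 (λ k t′ →
          (k :* (con 1 :+ t′) :+ k) :* (con 1 :+ t′) :=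
          k :* con 2 :* (con 1 :+ t′) :+ k :* t′ :* (con 1 :+ t′)) refl k t′ ⟩
        k * 2 * t + k * t′ * t                ∎)
        where open ≡-Reasoning

      |zs′| : length zs′ ≡ k * 2 * t
      |zs′| = +-cancelˡ-≡ (k * t * t) _ _ (begin
        k * t * t + length zs′                ≡⟨ cong₂ _+_ (cong (_* t) (sym |R|)) (sym (length-map class zs′)) ⟩
        length R * t + length (map class zs′) ≡⟨ cong (_+ length (map class zs′)) (Tileable-length tiles₂) ⟨
        length K₂ + length (map class zs′)    ≡⟨ length-++ K₂ ⟨
        length (K₂ ++ map class zs′)          ≡⟨ ↭-length p₂ ⟨
        length (R ++ map class zs)            ≡⟨ length-++ R ⟩
        length R + length (map class zs)      ≡⟨ cong₂ _+_ |R| (trans (length-map class zs) |zs|) ⟩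
        k * t + N                             ≡⟨ solve 2 (λ k t →
          k :* t :+ (k :* t :+ k) :* t := k :* t :* t :+ k :* con 2 :* t) refl k t ⟩
        k * t * t + k * 2 * t                 ∎)
        where open ≡-Reasoning

    tiling : ∀ r L → tilingBound t coverBound ≤ r → length L ≡ r * t → Unique L → Tileable r L
    tiling r []      r₀≤r |L| u =
      ⊥-elim (<⇒≢ (*-mono-≤ (≤-trans (s≤s z≤n) r₀≤r) (s≤s {0} {t′} z≤n)) |L|)
    tiling r (l ∷ L) r₀≤r |L| u
      with cover N l L (≤-pred (≤-trans (≤-trans (≤-trans (m≤m+n _ (h + h + k)) r₀≤r)
                                      (m≤m*n r t)) (≤-reflexive (sym |L|)))) u
    -- Only the biclique is reserved: the vertex found in `l` is dropped, and `l` returns to the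
    -- parts still to be tiled.
    ... | _ , ys , zs , _ , |ys| , |zs| , (R₀ , p₀) , _ , complete = conclude
      where
      -- The number of greedy tiles, chosen so that exactly `k * t` parts remain outside the
      -- reserve.
      j : ℕ
      j = r ∸ (h + h + k)

      h+h+k+j≡r : h + h + k + j ≡ r
      h+h+k+j≡r = m+[n∸m]≡n (≤-trans (m≤n+m _ (suc (coverBound N))) r₀≤r)

      YZ : List I
      YZ = map class ys ++ map class zs

      |YZ| : length YZ ≡ N + N
      |YZ| = trans (length-++ (map class ys))
               (cong₂ _+_ (trans (length-map class ys) |ys|) (trans (length-map class zs) |zs|))

      p : l ∷ L ↭ YZ ++ l ∷ R₀
      p = ↭-trans (prep l p₀) (↭-sym (shift l YZ R₀))

      |lR₀| : length (l ∷ R₀) ≡ k * t + j * t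
      |lR₀| = +-cancelˡ-≡ (N + N) _ _ (begin
        N + N + length (l ∷ R₀)         ≡⟨ cong (_+ length (l ∷ R₀)) |YZ| ⟨
        length YZ + length (l ∷ R₀)     ≡⟨ length-++ YZ ⟨
        length (YZ ++ l ∷ R₀)           ≡⟨ ↭-length p ⟨
        length (l ∷ L)                  ≡⟨ |L| ⟩
        r * t                           ≡⟨ cong (_* t) h+h+k+j≡r ⟨
        (h + h + k + j) * t             ≡⟨ solve 4 (λ h k j t → (h :+ h :+ k :+ j) :* t :=
                                             (h :* t :+ h :* t) :+ (k :* t :+ j :* t)) refl h k j t ⟩
        N + N + (k * t + j * t)         ∎)
        where open ≡-Reasoning
              open +-*-Solver

      conclude : Tileable r (l ∷ L)
      conclude
        with peel j (l ∷ R₀) (subst (suc M + j * t ≤_) (sym |lR₀|) (+-monoˡ-≤ (j * t) k≤k*t))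
               (≼-Unique (YZ , ↭-trans p (++-comm YZ (l ∷ R₀))) u)
      ... | K , R , q , tiles , |R|+ =
        let s , tiles′ = absorb ys zs R |ys| |zs| complete
              (+-cancelʳ-≡ (j * t) _ _ (trans |R|+ |lR₀|))
              (≼-Unique (K , ↭-trans perm (++-comm K _)) u)
            all-tiles = Tileable-↭ perm (Tileable-++ tiles tiles′)
        -- The number of tiles found must be `r`, since either number times `t` counts all the
        -- parts.
        in subst (λ r → Tileable r (l ∷ L))
             (*-cancelʳ-≡ (j + s) r t (trans (sym (Tileable-length all-tiles)) |L|)) all-tiles
        where
        open PermutationReasoning
        perm : l ∷ L ↭ K ++ map class ys ++ map class zs ++ R
        perm = begin
          l ∷ L                                     ↭⟨ p ⟩
          YZ ++ l ∷ R₀                              ↭⟨ ++⁺ˡ YZ q ⟩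
          YZ ++ K ++ R                              ↭⟨ shifts YZ K ⟩
          K ++ YZ ++ R                              ≡⟨ cong (K ++_) (++-assoc (map class ys) _ R) ⟩
          K ++ map class ys ++ map class zs ++ R    ∎

-- From a tiling of the parts to a traversal

Unique-tabulate⁻ : ∀ {n} (f : Fin n → A) → Unique (tabulate f) → ∀ {i j} → f i ≡ f j → i ≡ j
Unique-tabulate⁻ f u        {zero}  {zero}  eq = refl
Unique-tabulate⁻ f (x∉ ∷ u) {zero}  {suc j} eq = ⊥-elim (All.lookup x∉ (∈-tabulate⁺ j) eq)
Unique-tabulate⁻ f (x∉ ∷ u) {suc i} {zero}  eq = ⊥-elim (All.lookup x∉ (∈-tabulate⁺ i) (sym eq))
Unique-tabulate⁻ f (_ ∷ u)  {suc i} {suc j} eq = cong suc (Unique-tabulate⁻ (f ∘ suc) u eq)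

Unique-disjoint : ∀ (xs : List A) {ys x} → Unique (xs ++ ys) → x ∈ xs → ¬ x ∈ ys
Unique-disjoint (x ∷ xs) (x∉ ∷ u) (here refl) x∈ys = All.lookup x∉ (∈-++⁺ʳ xs x∈ys) refl
Unique-disjoint (x ∷ xs) (_ ∷ u) (there x∈) x∈ys = Unique-disjoint xs u x∈ x∈ys

module Assemble {I V : Set} (adj : V → V → Bool) (adj-sym : ∀ u v → adj u v ≡ adj v u)
  (class : V → I) {t′ : ℕ} (F : Graph (suc t′))
  (colour : Fin (suc t′) → Bool) (proper : ∀ u v → Adj F u v → colour u ≢ colour v)
  where

  open Tiling adj adj-sym class F colour proper
  open Tile

  vertexAt : ∀ {r L} → Tileable r L → Fin r → Fin t → V
  vertexAt (f ∷⟨ _ ⟩ _)     zero    u = vertex f u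
  vertexAt (_ ∷⟨ _ ⟩ tiles) (suc k) u = vertexAt tiles k u

  vertexAt-hom : ∀ {r L} (tiles : Tileable r L) k u v → Adj F u v →
    T (adj (vertexAt tiles k u) (vertexAt tiles k v))
  vertexAt-hom (f ∷⟨ _ ⟩ _)     zero    = hom f
  vertexAt-hom (_ ∷⟨ _ ⟩ tiles) (suc k) = vertexAt-hom tiles k

  parts≡tabulate : ∀ f → parts f ≡ tabulate (class ∘ vertex f)
  parts≡tabulate f = map-tabulate (vertex f) class

  ∈-parts : ∀ f u → class (vertex f u) ∈ parts f
  ∈-parts f u = subst (class (vertex f u) ∈_) (sym (parts≡tabulate f)) (∈-tabulate⁺ {f = class ∘ vertex f} u)

  vertexAt-∈ : ∀ {r L} (tiles : Tileable r L) k u → class (vertexAt tiles k u) ∈ L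
  vertexAt-∈ (f ∷⟨ p ⟩ _)     zero    u = ∈-resp-↭ (↭-sym p) (∈-++⁺ˡ (∈-parts f u))
  vertexAt-∈ (f ∷⟨ p ⟩ tiles) (suc k) u = ∈-resp-↭ (↭-sym p) (∈-++⁺ʳ (parts f) (vertexAt-∈ tiles k u))

  -- Without repetitions in `L`, a part occurs in one tile only and once within it, so the part
  -- alone identifies both the tile and the vertex of `F`.
  vertexAt-injective : ∀ {r L} (tiles : Tileable r L) → Unique L → ∀ {k l u v} →
    class (vertexAt tiles k u) ≡ class (vertexAt tiles l v) → (k , u) ≡ (l , v)
  vertexAt-injective (f ∷⟨ p ⟩ tiles) uniq {zero} {zero} eq =
    cong (zero ,_) (Unique-tabulate⁻ (class ∘ vertex f)
      (subst Unique (parts≡tabulate f) (≼-Unique (_ , p) uniq)) eq)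
  vertexAt-injective (f ∷⟨ p ⟩ tiles) uniq {zero} {suc l} {u} {v} eq =
    ⊥-elim (Unique-disjoint (parts f) (Unique-resp-↭ p uniq) (∈-parts f u)
      (subst (_∈ _) (sym eq) (vertexAt-∈ tiles l v)))
  vertexAt-injective (f ∷⟨ p ⟩ tiles) uniq {suc k} {zero} {u} {v} eq =
    ⊥-elim (Unique-disjoint (parts f) (Unique-resp-↭ p uniq) (∈-parts f v)
      (subst (_∈ _) eq (vertexAt-∈ tiles k u)))
  vertexAt-injective (f ∷⟨ p ⟩ tiles) uniq {suc k} {suc l} eq
    with refl ← vertexAt-injective tiles
      (≼-Unique (parts f , ↭-trans p (++-comm (parts f) _)) uniq) {k} {l} eq = refl

  vertexAt-surjective : ∀ {r L} (tiles : Tileable r L) {i} → i ∈ L →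
    ∃[ k ] ∃[ u ] class (vertexAt tiles k u) ≡ i
  vertexAt-surjective (f ∷⟨ p ⟩ tiles) {i} i∈ with ∈-++⁻ (parts f) (∈-resp-↭ p i∈)
  ... | inj₁ i∈f with ∈-tabulate⁻ (subst (i ∈_) (parts≡tabulate f) i∈f)
  ...   | u , eq = zero , u , sym eq
  vertexAt-surjective (f ∷⟨ p ⟩ tiles) i∈ | inj₂ i∈L with vertexAt-surjective tiles i∈L
  ...   | k , u , eq = suc k , u , eq

  -- The traversal takes from each part the vertex by which a tile meets it. By `vertexAt-injective`
  -- this is the vertex that the tile itself uses (`s-φ`), so the edges within tiles survive.
  embed : ∀ {r L} (tiles : Tileable r L) → Unique L → (∀ i → i ∈ L) →
    Σ (I → V) λ s → (∀ i → class (s i) ≡ i) ×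
      Σ (Fin (r * t) → I) λ φ → Injective _≡_ _≡_ φ ×
        (∀ x y → Adj (copies r F) x y → T (adj (s (φ x)) (s (φ y))))
  embed {r} tiles uniq full = s , class-s , φ , φ-injective , φ-hom
    where
    s : I → V
    s i = let k , u , _ = vertexAt-surjective tiles (full i) in vertexAt tiles k u

    class-s : ∀ i → class (s i) ≡ i
    class-s i = proj₂ (proj₂ (vertexAt-surjective tiles (full i)))

    place-of : Fin (r * t) → V
    place-of x = uncurry (vertexAt tiles) (remQuot {r} t x)

    φ : Fin (r * t) → I
    φ x = class (place-of x)

    φ-injective : Injective _≡_ _≡_ φ
    φ-injective {x} {y} eq = trans (sym (combine-remQuot {r} t x))
      (trans (cong (uncurry combine) (vertexAt-injective tiles uniq eq)) (combine-remQuot {r} t y))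

    s-φ : ∀ x → s (φ x) ≡ place-of x
    s-φ x = cong (uncurry (vertexAt tiles)) (vertexAt-injective tiles uniq (class-s (φ x)))

    φ-hom : ∀ x y → Adj (copies r F) x y → T (adj (s (φ x)) (s (φ y)))
    φ-hom x y xy with Equivalence.to T-∧ xy
    ... | same , edge = subst₂ (λ p q → T (adj p q)) (sym (s-φ x)) (sym (s-φ y))
      (subst (λ k → T (adj (place-of x) (vertexAt tiles k (proj₂ (remQuot {r} t y)))))
        (toWitness same)
        (vertexAt-hom tiles (proj₁ (remQuot {r} t x)) _ _ edge))

-- Supplies the vertex coloured false that `Covering` asks for; the two colours are swapped if need
-- be.
zero-false : ∀ {t} (F : Graph (suc t)) → Bipartite F →
  ∃[ c ] (∀ u v → Adj F u v → c u ≢ c v) × c zero ≡ false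
zero-false F (c , proper) with c zero in eq
... | false = c , proper , eq
... | true  = not ∘ c , (λ u v uv → proper u v uv ∘ not-injective) , cong not eq

traversal-bound : ∀ t′ c b → ℕ
traversal-bound t′ c b = tilingBound (suc t′) (coverBound (c + b))

has-traversal : ∀ t′ (F : Graph (suc t′)) → Bipartite F →
  ∀ c b → .{{NonZero (c + b)}} → b * b ≤ c * (c + b) →
  ∀ r → traversal-bound t′ c b ≤ r → (G : MultipartiteGraph (r * suc t′)) →
  (let open MultipartiteGraph G) →
  (∀ i j → i Fin.< j → suc c * (length (part i) * length (part j)) ≤ (c + b) * edges (part i) (part j)) →
  HasTraversal (copies r F) G
has-traversal t′ F bip c b b²≤ r r≥ G dense with zero-false F bip
... | colour , proper , zero-is-false = embed tiles (allFin⁺ _) ∈-allFin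
  where
  open MultipartiteGraph G using (part; part-nonZero; edges)
  open Parts (class G) part (λ {i} v∈ → proj₂ (∈-filter⁻ (λ v → class G v Fin.≟ i) {xs = allFin _} v∈)) part-nonZero

  gadj = adj (graph G)
  gadj-sym = Graph.symm (graph G)

  edges≡between : ∀ i j → edges (part i) (part j) ≡ between gadj i j
  edges≡between i j = trans (length-filterᵇ (uncurry gadj) (cartesianProduct (part i) (part j)))
    (∑-cartesianProduct (part i) (part j) _)

  between-comm : ∀ i j → between gadj i j ≡ between gadj j i
  between-comm i j = trans (∑-swap (part i) (part j) _)
    (∑-cong (part j) (λ z → ∑-cong (part i) (λ y → cong 𝟙 (gadj-sym y z))))

  dense′ : ∀ {i j} → i ≢ j → suc c * (size j * size i) ≤ (c + b) * between gadj i j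
  dense′ {i} {j} i≢j with Fin.<-cmp i j
  ... | tri< i<j _ _ = subst₂ (λ s e → suc c * s ≤ (c + b) * e) (*-comm (size i) (size j))
                         (edges≡between i j) (dense i j i<j)
  ... | tri≈ _ i≡j _ = ⊥-elim (i≢j i≡j)
  ... | tri> _ _ j<i = subst (λ e → suc c * (size j * size i) ≤ (c + b) * e)
                         (trans (edges≡between j i) (between-comm j i)) (dense j i j<i)

  open Cover gadj gadj-sym c b b²≤ dense′ using (cover)
  open Assemble gadj gadj-sym (class G) F colour proper using (embed)
  open Tiling gadj gadj-sym (class G) F colour proper using (module Covering; Tileable)
  open Covering zero zero-is-false (coverBound (c + b)) cover using (tiling)

  tiles : Tileable r (allFin (r * suc t′))
  tiles = tiling r (allFin _) r≥ (length-tabulate id) (allFin⁺ _)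

-- The extremal graph

Unique-lookup : ∀ {xs : List A} → Unique xs → ∀ {i j} → lookup xs i ≡ lookup xs j → i ≡ j
Unique-lookup (x∉ ∷ u) {zero}  {zero}  eq = refl
Unique-lookup (x∉ ∷ u) {zero}  {suc j} eq = ⊥-elim (All.lookup x∉ (∈-lookup j) eq)
Unique-lookup (x∉ ∷ u) {suc i} {zero}  eq = ⊥-elim (All.lookup x∉ (∈-lookup i) (sym eq))
Unique-lookup (x∉ ∷ u) {suc i} {suc j} eq = cong suc (Unique-lookup u eq)

-- A walk from `w` can only step to a neighbour and back, so the component consists of `w` and its
-- neighbours, and no two of these are adjacent. An isolated `w` gives the star with no leaves.
star-component : ∀ {n} (F : Graph n) w →
  (∀ u v → Adj F w u → Adj F u v → v ≡ w) → HasStarComponent F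
star-component {n} F w leaf =
  length nbrs , f , f-injective , f-adj , λ v → mk⇔ (reach zero refl) (λ { (i , refl) → connected i })
  where
  nbrs = filterᵇ (adj F w) (allFin n)

  f : Fin (suc (length nbrs)) → Fin n
  f zero    = w
  f (suc i) = lookup nbrs i

  w~ : ∀ i → Adj F w (lookup nbrs i)
  w~ i = proj₂ (∈-filter⁻ (T? ∘ adj F w) {xs = allFin n} (∈-lookup {xs = nbrs} i))

  w≁w : ¬ Adj F w w
  w≁w = subst T (Graph.irrefl F w)

  ~w : ∀ {u} → Adj F w u → Adj F u w
  ~w = subst T (Graph.symm F w _)

  f-injective : Injective _≡_ _≡_ f
  f-injective {zero}  {zero}  eq = refl
  f-injective {zero}  {suc j} eq = ⊥-elim (w≁w (subst (Adj F w) (sym eq) (w~ j)))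
  f-injective {suc i} {zero}  eq = ⊥-elim (w≁w (subst (Adj F w) eq (w~ i)))
  f-injective {suc i} {suc j} eq = cong suc (Unique-lookup (filter⁺ (T? ∘ adj F w) (allFin⁺ n)) eq)

  true⇒ : ∀ {a} → T a → a ≡ true
  true⇒ = Equivalence.to T-≡

  f-adj : ∀ i j → adj F (f i) (f j) ≡ adj (K₁ _) i j
  f-adj zero    zero    = Graph.irrefl F w
  f-adj zero    (suc j) = true⇒ (w~ j)
  f-adj (suc i) zero    = true⇒ (~w (w~ i))
  f-adj (suc i) (suc j) with adj F (lookup nbrs i) (lookup nbrs j) in eq
  ... | false = refl
  ... | true  = ⊥-elim (w≁w (subst (Adj F w)
                  (leaf _ _ (w~ i) (Equivalence.from T-≡ eq)) (w~ j)))

  connected : ∀ i → Star (Adj F) w (f i)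
  connected zero    = nil
  connected (suc i) = w~ i ◅ nil

  reach : ∀ i {u v} → f i ≡ u → Star (Adj F) u v → ∃[ j ] f j ≡ v
  reach i       eq nil = i , eq
  reach (suc i) refl (u~ ◅ path) = reach zero (sym (leaf _ _ (w~ i) u~)) path
  reach zero    refl (_◅_ {j = u} w~u path) =
    reach (suc (Any.index u∈)) (sym (lookup-index u∈)) path
    where
    u∈ : u ∈ nbrs
    u∈ = ∈-filter⁺ (T? ∘ adj F w) (∈-allFin u) w~u

injective⇒hits : ∀ {m} (φ : Fin m → Fin m) → Injective _≡_ _≡_ φ → ∀ i → ∃[ x ] φ x ≡ i
injective⇒hits {suc m} φ inj i with any? (λ x → φ x Fin.≟ i)
... | yes hit = hit
... | no miss = ⊥-elim (1+n≰n (injective⇒≤ {f = λ x → punchOut (i≢φ x)}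
                  (λ {x} {y} eq → inj (punchOut-injective (i≢φ x) (i≢φ y) eq))))
  where
  i≢φ : ∀ x → i ≢ φ x
  i≢φ x eq = miss (x , sym eq)

∑-tabulate : ∀ {n} (f : Fin n → A) g → ∑ (tabulate f) g ≡ ∑ (allFin n) (g ∘ f)
∑-tabulate {n = zero}  f g = refl
∑-tabulate {n = suc n} f g = cong (λ s → g (f zero) + s)
  (trans (∑-tabulate (f ∘ suc) g) (sym (∑-tabulate suc (g ∘ f))))

∑-↑ : ∀ a b (g : Fin (a + b) → ℕ) →
  ∑ (allFin (a + b)) g ≡ ∑ (allFin a) (λ x → g (x Fin.↑ˡ b)) + ∑ (allFin b) (λ y → g (a Fin.↑ʳ y))
∑-↑ zero    b g = refl
∑-↑ (suc a) b g = begin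
  g zero + ∑ (tabulate suc) g
    ≡⟨ cong (λ s → g zero + s) (trans (∑-tabulate suc g) (∑-↑ a b (g ∘ suc))) ⟩
  g zero + (∑ (allFin a) (λ x → g (suc (x Fin.↑ˡ b))) + ∑ (allFin b) (λ y → g (suc (a Fin.↑ʳ y))))
    ≡⟨ +-assoc (g zero) _ _ ⟨
  g zero + ∑ (allFin a) (λ x → g (suc x Fin.↑ˡ b)) + ∑ (allFin b) (λ y → g (suc a Fin.↑ʳ y))
    ≡⟨ cong (λ s → g zero + s + ∑ (allFin b) (λ y → g (suc a Fin.↑ʳ y)))
         (∑-tabulate suc (λ x → g (x Fin.↑ˡ b))) ⟨
  ∑ (allFin (suc a)) (λ x → g (x Fin.↑ˡ b)) + ∑ (allFin b) (λ y → g (suc a Fin.↑ʳ y))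
    ∎
  where open ≡-Reasoning

∑-combine : ∀ m n (g : Fin (m * n) → ℕ) →
  ∑ (allFin (m * n)) g ≡ ∑ (allFin m) (λ i → ∑ (allFin n) (λ x → g (combine i x)))
∑-combine zero    n g = refl
∑-combine (suc m) n g = trans (∑-↑ n (m * n) g) (cong (λ s → ∑ (allFin n) (λ x → g (x Fin.↑ˡ (m * n))) + s)
  (trans (∑-combine m n (g ∘ (n Fin.↑ʳ_)))
         (sym (∑-tabulate {n = m} suc (λ i → ∑ (allFin n) (λ x → g (combine {suc m} i x)))))))

∑-indicator : ∀ {m} (h : Fin m → ℕ) i → ∑ (allFin m) (λ j → 𝟙 (does (j Fin.≟ i)) * h j) ≡ h i
∑-indicator {suc m} h zero = begin
  1 * h zero + ∑ (tabulate suc) g             ≡⟨ cong₂ _+_ (*-identityˡ _) (∑-tabulate suc g) ⟩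
  h zero + ∑ (allFin m) (λ _ → 0)             ≡⟨ cong (λ s → h zero + s) (∑-const (allFin m) 0) ⟩
  h zero + 0                                  ≡⟨ +-identityʳ _ ⟩
  h zero                                      ∎
  where
  open ≡-Reasoning
  g = λ j → 𝟙 (does (j Fin.≟ zero)) * h j
∑-indicator {suc m} h (suc i) =
  trans (∑-tabulate suc (λ j → 𝟙 (does (j Fin.≟ suc i)) * h j)) (∑-indicator (h ∘ suc) i)

∑-filter : ∀ {P : A → Set} (P? : ∀ x → Dec (P x)) xs f →
  ∑ (filter P? xs) f ≡ ∑ xs (λ x → 𝟙 (does (P? x)) * f x)
∑-filter P? []       f = refl
∑-filter P? (x ∷ xs) f with does (P? x)
... | true  = cong₂ _+_ (sym (*-identityˡ (f x))) (∑-filter P? xs f)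
... | false = ∑-filter P? xs f

#-<ᵇ : ∀ k b → # (λ x → toℕ x <ᵇ k) (allFin (k + b)) ≡ k
#-<ᵇ zero    b = ∑-const (allFin b) 0
#-<ᵇ (suc k) b = cong suc (trans (∑-tabulate {n = k + b} suc (λ x → 𝟙 (toℕ x <ᵇ suc k))) (#-<ᵇ k b))

-- The densities are k / n at part zero and (b / n)² elsewhere.
module Extremal (m k b : ℕ) .{{_ : NonZero (k + b)}} where

  n = k + b

  inA : Fin (suc m * n) → Bool
  inA v = toℕ (proj₂ (remQuot {suc m} n v)) <ᵇ k

  part-of : Fin (suc m * n) → Fin (suc m)
  part-of v = proj₁ (remQuot {suc m} n v)

  joined : Fin (suc m) → Bool → Fin (suc m) → Bool → Bool
  joined zero    x zero    y = false
  joined zero    x (suc j) y = y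
  joined (suc i) x zero    y = x
  joined (suc i) x (suc j) y = not ⌊ i Fin.≟ j ⌋ ∧ (not x ∧ not y)

  joined-sym : ∀ i x j y → joined i x j y ≡ joined j y i x
  joined-sym zero    x zero    y = refl
  joined-sym zero    x (suc j) y = refl
  joined-sym (suc i) x zero    y = refl
  joined-sym (suc i) x (suc j) y = cong₂ (λ p q → not p ∧ q) (≟-sym i j) (∧-comm (not x) (not y))
    where
    ≟-sym : ∀ (i j : Fin m) → ⌊ i Fin.≟ j ⌋ ≡ ⌊ j Fin.≟ i ⌋
    ≟-sym i j with i Fin.≟ j | j Fin.≟ i
    ... | yes _   | yes _   = refl
    ... | no  _   | no  _   = refl
    ... | yes i≡j | no  j≢i = ⊥-elim (j≢i (sym i≡j))
    ... | no  i≢j | yes j≡i = ⊥-elim (i≢j (sym j≡i))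

  joined-irrefl : ∀ i x y → joined i x i y ≡ false
  joined-irrefl zero    x y = refl
  joined-irrefl (suc i) x y with i Fin.≟ i
  ... | yes _   = refl
  ... | no  i≢i = ⊥-elim (i≢i refl)

  G : MultipartiteGraph (suc m)
  G = record
    { graph = record
      { adj    = λ u v → joined (part-of u) (inA u) (part-of v) (inA v)
      ; symm   = λ u v → joined-sym (part-of u) (inA u) (part-of v) (inA v)
      ; irrefl = λ v → joined-irrefl (part-of v) (inA v) (inA v)
      }
    ; class = part-of
    ; independent = λ u v uv eq → subst T (joined-irrefl (part-of u) (inA u) (inA v))
        (subst (λ i → T (joined (part-of u) (inA u) i (inA v))) (sym eq) uv)
    ; nonempty = λ i → combine i origin , cong proj₁ (remQuot-combine i origin)
    }
    where
    origin : Fin n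
    origin = Fin.fromℕ< (>-nonZero⁻¹ n)

  open MultipartiteGraph G using (part; edges)

  -- `combine` numbers the vertices in blocks, one block per part, so filtering by class leaves the
  -- block of `i`.
  ∑-part : ∀ i f → ∑ (part i) f ≡ ∑ (allFin n) (λ x → f (combine i x))
  ∑-part i f = begin
    ∑ (part i) f
      ≡⟨ ∑-filter (λ v → part-of v Fin.≟ i) (allFin (suc m * n)) f ⟩
    ∑ (allFin (suc m * n)) (λ v → 𝟙 (does (part-of v Fin.≟ i)) * f v)
      ≡⟨ ∑-combine (suc m) n _ ⟩
    ∑ (allFin (suc m)) (λ j → ∑ (allFin n) (λ x → 𝟙 (does (part-of (combine j x) Fin.≟ i)) * f (combine j x)))
      ≡⟨ ∑-cong (allFin (suc m)) (λ j → trans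
           (∑-cong (allFin n) (λ x → cong (λ p → 𝟙 (does (proj₁ p Fin.≟ i)) * f (combine j x)) (remQuot-combine j x)))
           (∑-* (allFin n) (𝟙 (does (j Fin.≟ i))) _)) ⟩
    ∑ (allFin (suc m)) (λ j → 𝟙 (does (j Fin.≟ i)) * ∑ (allFin n) (λ x → f (combine j x)))
      ≡⟨ ∑-indicator (λ j → ∑ (allFin n) (λ x → f (combine j x))) i ⟩
    ∑ (allFin n) (λ x → f (combine i x))
      ∎
    where open ≡-Reasoning

  length-allFin : ∀ {n} → length (allFin n) ≡ n
  length-allFin = length-tabulate id

  length-part : ∀ i → length (part i) ≡ n
  length-part i = begin
    length (part i)         ≡⟨ *-identityˡ _ ⟨
    1 * length (part i)     ≡⟨ ∑-const (part i) 1 ⟨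
    ∑ (part i) (λ _ → 1)    ≡⟨ ∑-part i _ ⟩
    ∑ (allFin n) (λ _ → 1)  ≡⟨ ∑-const (allFin n) 1 ⟩
    1 * length (allFin n)   ≡⟨ *-identityˡ _ ⟩
    length (allFin n)       ≡⟨ length-allFin ⟩
    n                       ∎
    where open ≡-Reasoning

  a : Fin n → Bool
  a x = toℕ x <ᵇ k

  edges-part : ∀ i j →
    edges (part i) (part j) ≡ ∑ (allFin n) (λ x → ∑ (allFin n) (λ y → 𝟙 (joined i (a x) j (a y))))
  edges-part i j = begin
    edges (part i) (part j)
      ≡⟨ trans (length-filterᵇ _ (cartesianProduct (part i) (part j))) (∑-cartesianProduct (part i) (part j) _) ⟩
    ∑ (part i) (λ u → ∑ (part j) (λ v → e u v))
      ≡⟨ ∑-part i _ ⟩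
    ∑ (allFin n) (λ x → ∑ (part j) (e (combine i x)))
      ≡⟨ ∑-cong (allFin n) (λ x → ∑-part j _) ⟩
    ∑ (allFin n) (λ x → ∑ (allFin n) (λ y → e (combine i x) (combine j y)))
      ≡⟨ ∑-cong (allFin n) (λ x → ∑-cong (allFin n) (λ y →
           cong₂ (λ p q → 𝟙 (joined (proj₁ p) (a (proj₂ p)) (proj₁ q) (a (proj₂ q))))
             (remQuot-combine i x) (remQuot-combine j y))) ⟩
    ∑ (allFin n) (λ x → ∑ (allFin n) (λ y → 𝟙 (joined i (a x) j (a y))))
      ∎
    where
    open ≡-Reasoning
    e = λ u v → 𝟙 (adj (graph G) u v)

  #a : # a (allFin n) ≡ k
  #a = #-<ᵇ k b

  #¬a : # (not ∘ a) (allFin n) ≡ b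
  #¬a = +-cancelˡ-≡ k _ _ (begin
    k + # (not ∘ a) (allFin n)               ≡⟨ cong (_+ # (not ∘ a) (allFin n)) #a ⟨
    # a (allFin n) + # (not ∘ a) (allFin n)  ≡⟨ ∑-+ (allFin n) _ _ ⟨
    ∑ (allFin n) (λ x → 𝟙 (a x) + 𝟙 (not (a x)))
                                             ≡⟨ ∑-cong (allFin n) (λ x → total (a x)) ⟩
    ∑ (allFin n) (λ _ → 1)                   ≡⟨ ∑-const (allFin n) 1 ⟩
    1 * length (allFin n)                    ≡⟨ trans (*-identityˡ _) length-allFin ⟩
    n                                        ∎)
    where
    open ≡-Reasoning
    total : ∀ c → 𝟙 c + 𝟙 (not c) ≡ 1
    total true  = refl
    total false = refl

  edges-zero : ∀ j → edges (part zero) (part (suc j)) ≡ k * n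
  edges-zero j = begin
    edges (part zero) (part (suc j))        ≡⟨ edges-part zero (suc j) ⟩
    ∑ (allFin n) (λ x → # a (allFin n))     ≡⟨ ∑-const (allFin n) _ ⟩
    # a (allFin n) * length (allFin n)      ≡⟨ cong₂ _*_ #a length-allFin ⟩
    k * n                                   ∎
    where open ≡-Reasoning

  edges-suc : ∀ i j → i ≢ j → edges (part (suc i)) (part (suc j)) ≡ b * b
  edges-suc i j i≢j = begin
    edges (part (suc i)) (part (suc j))
      ≡⟨ edges-part (suc i) (suc j) ⟩
    ∑ (allFin n) (λ x → ∑ (allFin n) (λ y → 𝟙 (joined (suc i) (a x) (suc j) (a y))))
      ≡⟨ ∑-cong (allFin n) (λ x → trans (∑-cong (allFin n) (λ y → product (a x) (a y)))
           (∑-* (allFin n) (𝟙 (not (a x))) _)) ⟩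
    ∑ (allFin n) (λ x → 𝟙 (not (a x)) * # (not ∘ a) (allFin n))
      ≡⟨ ∑-cong (allFin n) (λ x → trans (cong (𝟙 (not (a x)) *_) #¬a) (*-comm _ b)) ⟩
    ∑ (allFin n) (λ x → b * 𝟙 (not (a x)))
      ≡⟨ trans (∑-* (allFin n) b _) (cong (b *_) #¬a) ⟩
    b * b
      ∎
    where
    open ≡-Reasoning
    product : ∀ x y → 𝟙 (joined (suc i) x (suc j) y) ≡ 𝟙 (not x) * 𝟙 (not y)
    product x y with i Fin.≟ j
    ... | yes i≡j = ⊥-elim (i≢j i≡j)
    product true  y     | no _ = refl
    product false true  | no _ = refl
    product false false | no _ = refl

  dense : k * n ≤ b * b → ∀ i j → i Fin.< j →
    k * (length (part i) * length (part j)) ≤ n * edges (part i) (part j)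
  dense kn≤b² i j i<j rewrite length-part i | length-part j = bound i j i<j
    where
    open ≤-Reasoning
    rearrange : k * (n * n) ≡ n * (k * n)
    rearrange = trans (sym (*-assoc k n n)) (*-comm (k * n) n)

    bound : ∀ i j → i Fin.< j → k * (n * n) ≤ n * edges (part i) (part j)
    bound zero    (suc j) i<j = ≤-reflexive (trans rearrange (cong (n *_) (sym (edges-zero j))))
    bound (suc i) (suc j) i<j = begin
      k * (n * n)  ≡⟨ rearrange ⟩
      n * (k * n)  ≤⟨ *-monoʳ-≤ n kn≤b² ⟩
      n * (b * b)  ≡⟨ cong (n *_) (edges-suc i j (Fin.<⇒≢ i<j ∘ cong suc)) ⟨
      n * edges (part (suc i)) (part (suc j)) ∎

  -- A neighbour of part zero lies on an A-side, and a vertex on the A-side of another part has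
  -- neighbours in part zero only.
  joined-path : ∀ j l x y z → T (joined zero x j y) → T (joined j y l z) → l ≡ zero
  joined-path (suc j) zero    x y    z _ _   = refl
  joined-path (suc j) (suc l) x true z _ j~l =
    ⊥-elim (subst T (∧-zeroʳ (not ⌊ j Fin.≟ l ⌋)) j~l)

copies-adj : ∀ r {t} (F : Graph t) k {u v} → Adj F u v →
  Adj (copies r F) (combine k u) (combine k v)
copies-adj r {t} F k {u} {v} uv = Equivalence.from T-∧
  ( fromWitness (trans (cong proj₁ (remQuot-combine k u)) (sym (cong proj₁ (remQuot-combine k v))))
  , subst₂ (Adj F) (sym (cong proj₂ (remQuot-combine k u))) (sym (cong proj₂ (remQuot-combine k v))) uv)

-- Let `w` be the vertex of `F` placed in part zero. A path of two edges from it returns to part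
-- zero, where the traversal has a single vertex, so the component of `w` in `F` would be a star.
no-traversal : ∀ r t′ (F : Graph (suc t′)) → ¬ HasStarComponent F →
  ∀ k b .{{_ : NonZero (k + b)}} →
  ¬ HasTraversal (copies (suc r) F) (Extremal.G (t′ + r * suc t′) k b)
no-traversal r t′ F no-star k b (s , class-s , φ , φ-injective , φ-hom) = no-star (star-component F w leaf)
  where
  open Extremal (t′ + r * suc t′) k b
  t = suc t′

  -- The copies have as many vertices as there are parts, so the injection `φ` is onto and some
  -- vertex lands in part zero.
  x₀ : Fin (suc r * t)
  x₀ = proj₁ (injective⇒hits φ φ-injective zero)

  copy : Fin (suc r)
  copy = proj₁ (remQuot {suc r} t x₀)

  w : Fin t
  w = proj₂ (remQuot {suc r} t x₀)

  φ-w : φ (combine copy w) ≡ zero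
  φ-w = trans (cong φ (combine-remQuot {suc r} t x₀)) (proj₂ (injective⇒hits φ φ-injective zero))

  image : Fin t → Fin (suc r * t)
  image u = φ (combine copy u)

  edge : ∀ {u v} → Adj F u v →
    T (joined (image u) (inA (s (image u))) (image v) (inA (s (image v))))
  edge {u} {v} uv = subst₂ (λ i j → T (joined i (inA (s (image u))) j (inA (s (image v)))))
    (class-s (image u)) (class-s (image v)) (φ-hom _ _ (copies-adj (suc r) F copy uv))

  leaf : ∀ u v → Adj F w u → Adj F u v → v ≡ w
  leaf u v wu uv = combine-injectiveʳ copy v copy w (φ-injective (trans
    (joined-path (image u) (image v) (inA (s (image w))) (inA (s (image u))) (inA (s (image v)))
      (subst (λ i → T (joined i (inA (s (image w))) (image u) (inA (s (image u))))) φ-w (edge wu))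
      (edge uv))
    (sym φ-w)))

-- Rational densities and the golden value

/-toℚᵘ : ∀ i n → toℚᵘ (i / suc n) ℚᵘ.≃ ℚᵘ.mkℚᵘ i n
/-toℚᵘ i n = ℚ.toℚᵘ-fromℚᵘ (ℚᵘ.mkℚᵘ i n)

/-mono-≤ : ∀ k c e d .{{_ : NonZero c}} .{{_ : NonZero d}} →
  k * d ≤ e * c → + k / c ℚ.≤ + e / d
/-mono-≤ k (suc c) e (suc d) le = ℚ.toℚᵘ-cancel-≤
  (ℚᵘ.≤-respˡ-≃ (ℚᵘ.≃-sym (/-toℚᵘ (+ k) c)) (ℚᵘ.≤-respʳ-≃ (ℚᵘ.≃-sym (/-toℚᵘ (+ e) d))
    (ℚᵘ.*≤* (subst₂ ℤ._≤_ (ℤ.pos-* k (suc d)) (ℤ.pos-* e (suc c)) (ℤ.+≤+ le)))))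

/-cancel-≤ : ∀ k c e d .{{_ : NonZero c}} .{{_ : NonZero d}} →
  + k / c ℚ.≤ + e / d → k * d ≤ e * c
/-cancel-≤ k (suc c) e (suc d) le
  with ℚᵘ.≤-respˡ-≃ (/-toℚᵘ (+ k) c) (ℚᵘ.≤-respʳ-≃ (/-toℚᵘ (+ e) d) (ℚ.toℚᵘ-mono-≤ le))
... | ℚᵘ.*≤* le′ = ℤ.drop‿+≤+ (subst₂ ℤ._≤_ (sym (ℤ.pos-* k (suc d))) (sym (ℤ.pos-* e (suc c))) le′)

/-+ : ∀ m n d .{{_ : NonZero d}} → + (m + n) / d ≡ + m / d ℚ.+ + n / d
/-+ m n (suc d) = ℚ.toℚᵘ-injective (begin
  toℚᵘ (+ (m + n) / suc d)                           ≈⟨ /-toℚᵘ _ d ⟩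
  ℚᵘ.mkℚᵘ (+ (m + n)) d                              ≈⟨ ℚᵘ.*≡* (solve 3 (λ m n d →
    (m :+ n) :* (d :* d) := (m :* d :+ n :* d) :* d) refl (+ m) (+ n) (+ suc d)) ⟩
  ℚᵘ.mkℚᵘ (+ m) d ℚᵘ.+ ℚᵘ.mkℚᵘ (+ n) d                 ≈⟨ ℚᵘ.+-cong (/-toℚᵘ (+ m) d) (/-toℚᵘ (+ n) d) ⟨
  toℚᵘ (+ m / suc d) ℚᵘ.+ toℚᵘ (+ n / suc d)           ≈⟨ ℚ.toℚᵘ-homo-+ (+ m / suc d) (+ n / suc d) ⟨
  toℚᵘ (+ m / suc d ℚ.+ + n / suc d)                   ∎)
  where
  open ℚᵘ.≃-Reasoning
  open ℤ.+-*-Solver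

/-* : ∀ m n c d .{{_ : NonZero c}} .{{_ : NonZero d}} .{{_ : NonZero (c * d)}} →
  + (m * n) / (c * d) ≡ (+ m / c) ℚ.* (+ n / d)
/-* m n (suc c) (suc d) = ℚ.toℚᵘ-injective (begin
  toℚᵘ (+ (m * n) / (suc c * suc d))               ≈⟨ /-toℚᵘ _ _ ⟩
  ℚᵘ.mkℚᵘ (+ (m * n)) (pred (suc c * suc d))     ≈⟨ ℚᵘ.*≡* (cong (ℤ._* (+ (suc c * suc d))) (ℤ.pos-* m n)) ⟩
  ℚᵘ.mkℚᵘ (+ m) c ℚᵘ.* ℚᵘ.mkℚᵘ (+ n) d                 ≈⟨ ℚᵘ.*-cong (/-toℚᵘ (+ m) c) (/-toℚᵘ (+ n) d) ⟨
  toℚᵘ (+ m / suc c) ℚᵘ.* toℚᵘ (+ n / suc d)           ≈⟨ ℚ.toℚᵘ-homo-* (+ m / suc c) (+ n / suc d) ⟨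
  toℚᵘ ((+ m / suc c) ℚ.* (+ n / suc d))               ∎)
  where open ℚᵘ.≃-Reasoning

n/n≡1 : ∀ n .{{_ : NonZero n}} → + n / n ≡ 1ℚ
n/n≡1 n = ℚ.≤-antisym (/-mono-≤ n n 1 1 (≤-reflexive (*-comm n 1)))
                      (/-mono-≤ 1 1 n n (≤-reflexive (*-comm 1 n)))

0≤p⇒p≡k/n : ∀ p → 0ℚ ℚ.≤ p → ∃[ k ] ∃[ n ] p ≡ + k / suc n
0≤p⇒p≡k/n p@(mkℚ (+ k) n _)      0≤p = k , n , sym (ℚ.↥p/↧p≡p p)
0≤p⇒p≡k/n p@(mkℚ -[1+ k ] n _) 0≤p with () ← ℚ.nonNegative 0≤p

foldr-⊓-≤ : ∀ {x} xs → x ∈ xs → foldr _⊓_ 1ℚ xs ℚ.≤ x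
foldr-⊓-≤ (x ∷ xs) (here refl) = ℚ.p⊓q≤p x _
foldr-⊓-≤ (x ∷ xs) (there x∈)  = ℚ.≤-trans (ℚ.p⊓q≤q x _) (foldr-⊓-≤ xs x∈)

≤-foldr-⊓ : ∀ {α} xs → α ℚ.≤ 1ℚ → (∀ {x} → x ∈ xs → α ℚ.≤ x) → α ℚ.≤ foldr _⊓_ 1ℚ xs
≤-foldr-⊓ []       α≤1 h = α≤1
≤-foldr-⊓ (x ∷ xs) α≤1 h = ℚ.⊓-glb (h (here refl)) (≤-foldr-⊓ xs α≤1 (h ∘ there))

module _ {m} (G : MultipartiteGraph m) where
  open MultipartiteGraph G using (part; part-nonZero; edges; density)

  partiteDensity-≤ : ∀ i j → i Fin.< j → partiteDensity G ℚ.≤ density i j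
  partiteDensity-≤ i j i<j = foldr-⊓-≤ _ (∈-map⁺ (uncurry density)
    (∈-filter⁺ _ (∈-cartesianProduct⁺ (∈-allFin i) (∈-allFin j)) i<j))

  ≤-partiteDensity : ∀ {α} → α ℚ.≤ 1ℚ → (∀ i j → i Fin.< j → α ℚ.≤ density i j) →
    α ℚ.≤ partiteDensity G
  ≤-partiteDensity α≤1 h = ≤-foldr-⊓ _ α≤1 λ x∈ →
    let (i , j) , ij∈ , eq = ∈-map⁻ (uncurry density) x∈
    in subst (_ ℚ.≤_) (sym eq) (h i j (proj₂ (∈-filter⁻ _ {xs = cartesianProduct (allFin m) (allFin m)} ij∈)))

  parts-nonZero : ∀ i j → NonZero (length (part i) * length (part j))
  parts-nonZero i j = m*n≢0 _ _ {{part-nonZero i}} {{part-nonZero j}}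

  ≤-density : ∀ k n .{{_ : NonZero n}} i j →
    k * (length (part i) * length (part j)) ≤ n * edges (part i) (part j) →
    + k / n ℚ.≤ density i j
  ≤-density k n i j le =
    let instance _ = parts-nonZero i j in
    /-mono-≤ k n (edges (part i) (part j)) (length (part i) * length (part j)) (≤-trans le (≤-reflexive (*-comm n (edges (part i) (part j)))))

  ≤-density⁻¹ : ∀ k n .{{_ : NonZero n}} i j → + k / n ℚ.≤ density i j →
    k * (length (part i) * length (part j)) ≤ n * edges (part i) (part j)
  ≤-density⁻¹ k n i j le =
    let instance _ = parts-nonZero i j in
    ≤-trans (/-cancel-≤ k n (edges (part i) (part j)) (length (part i) * length (part j)) le) (≤-reflexive (*-comm (edges (part i) (part j)) n))

-- The limit as a cut of the rationals

3ℚ 4ℚ 5ℚ : ℚ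
3ℚ = + 3 / 1
4ℚ = + 4 / 1
5ℚ = + 5 / 1

ℓ : ℝ̄
ℓ = (ι (+ 3 / 1) - √ (+ 5 / 1)) /2

-- Turns the comparison of `x` with (1 - x)² into one of (3 - 2x)² with 5, which is what the cut of
-- √5 speaks about.
golden-identity : ∀ x → (3ℚ ℚ.- (x ℚ.+ x)) ℚ.* (3ℚ ℚ.- (x ℚ.+ x)) ≡
  5ℚ ℚ.+ 4ℚ ℚ.* ((1ℚ ℚ.- x) ℚ.* (1ℚ ℚ.- x) ℚ.- x)
golden-identity = solve 1 (λ x →
  (con 3ℚ :- (x :+ x)) :* (con 3ℚ :- (x :+ x)) :=
  con 5ℚ :+ con 4ℚ :* ((con 1ℚ :- x) :* (con 1ℚ :- x) :- x)) refl
  where open ℚ.+-*-Solver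

p≤q⇒0≤q-p : ∀ {p q} → p ℚ.≤ q → 0ℚ ℚ.≤ q ℚ.- p
p≤q⇒0≤q-p {p} {q} p≤q = subst (ℚ._≤ q ℚ.- p) (ℚ.+-inverseʳ p) (ℚ.+-monoˡ-≤ (ℚ.- p) p≤q)

0≤q-p⇒p≤q : ∀ {p q} → 0ℚ ℚ.≤ q ℚ.- p → p ℚ.≤ q
0≤q-p⇒p≤q {p} {q} 0≤ = subst₂ ℚ._≤_ (ℚ.+-identityˡ p)
  (solve 2 (λ p q → (q :- p) :+ p := q) refl p q) (ℚ.+-monoˡ-≤ p 0≤)
  where open ℚ.+-*-Solver

/-mono-< : ∀ k c e d .{{_ : NonZero c}} .{{_ : NonZero d}} →
  k * d < e * c → + k / c ℚ.< + e / d
/-mono-< k c e d lt = ℚ.≰⇒> (λ le → <⇒≱ lt (/-cancel-≤ e d k c le))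

0<p⇒p≡k/n : ∀ p → 0ℚ ℚ.< p → ∃[ k ] ∃[ n ] p ≡ + suc k / suc n
0<p⇒p≡k/n p 0<p with 0≤p⇒p≡k/n p (ℚ.<⇒≤ 0<p)
... | suc k , n , eq = k , n , eq
... | zero  , n , eq = ⊥-elim (ℚ.<-irrefl (sym (trans eq (ℚ.0/n≡0 (suc n)))) 0<p)

double : ∀ {p q} → p ℚ.< q → p ℚ.+ p ℚ.< q ℚ.+ q
double p<q = ℚ.+-mono-< p<q p<q

square-mono-< : ∀ {p q} → 0ℚ ℚ.≤ p → p ℚ.< q → p ℚ.* p ℚ.< q ℚ.* q
square-mono-< {p} {q} 0≤p p<q = ℚ.≤-<-trans
  (ℚ.*-monoʳ-≤-nonNeg p {{ℚ.nonNegative 0≤p}} (ℚ.<⇒≤ p<q))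
  (ℚ.*-monoʳ-<-pos q {{ℚ.positive (ℚ.≤-<-trans 0≤p p<q)}} p<q)

-- By the identity, w = 3 - 2x has square at least 5. As x ≤ 1 makes w nonnegative, every rational
-- above w has a square greater than 5.
golden⇒√5≤ : ∀ x → x ℚ.≤ 1ℚ → x ℚ.≤ (1ℚ ℚ.- x) ℚ.* (1ℚ ℚ.- x) →
  ¬ (√ 5ℚ ∋ (3ℚ ℚ.- (x ℚ.+ x)))
golden⇒√5≤ x x≤1 x≤ (v , v²≤5 , w<v) = ℚ.<-irrefl refl (begin-strict
  5ℚ                                 ≡⟨ ℚ.+-identityʳ 5ℚ ⟨
  5ℚ ℚ.+ 4ℚ ℚ.* 0ℚ                   ≤⟨ ℚ.+-monoʳ-≤ 5ℚ (ℚ.*-monoˡ-≤-nonNeg 4ℚ (p≤q⇒0≤q-p x≤)) ⟩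
  5ℚ ℚ.+ 4ℚ ℚ.* ((1ℚ ℚ.- x) ℚ.* (1ℚ ℚ.- x) ℚ.- x)
                                     ≡⟨ golden-identity x ⟨
  w ℚ.* w                            <⟨ square-mono-< 0≤w w<v ⟩
  v ℚ.* v                            ≤⟨ v²≤5 ⟩
  5ℚ                                 ∎)
  where
  open ℚ.≤-Reasoning
  w = 3ℚ ℚ.- (x ℚ.+ x)

  0≤w : 0ℚ ℚ.≤ w
  0≤w = p≤q⇒0≤q-p (ℚ.≤-trans (ℚ.+-mono-≤ x≤1 x≤1) (ℚ.≤ᵇ⇒≤ {1ℚ ℚ.+ 1ℚ} {3ℚ} _))

ℓ∋⁺ : ∀ {p w} → ¬ (√ 5ℚ ∋ w) → p ℚ.+ p ℚ.< 3ℚ ℚ.- w → ℓ ∋ p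
ℓ∋⁺ {p} {w} √5≤w 2p<3-w =
  -- Each of the nested suprema asks for a strict inequality: `x` serves the halving, `y` the sum
  -- and `a` the embedded 3.
  let x , 2p<x , x<3-w = ℚ.<-dense 2p<3-w
      y , x<y , y<3-w = ℚ.<-dense x<3-w
      a , y+w<a , a<3 = ℚ.<-dense (subst (y ℚ.+ w ℚ.<_) (cancel w) (ℚ.+-monoˡ-< w y<3-w))
  in ½ ℚ.* x ,
     (x , (y , (a , y ℚ.- a , (3ℚ , refl , a<3) ,
                 (ℚ.- w , (w , √5≤w , refl) , y-a<-w y w a y+w<a) , sum-split y a) , x<y) , refl) ,
     subst (ℚ._< ½ ℚ.* x) (halve p) (ℚ.*-monoʳ-<-pos ½ 2p<x)
  where
  open ℚ.+-*-Solver
  cancel : ∀ w → (3ℚ ℚ.- w) ℚ.+ w ≡ 3ℚ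
  cancel = solve 1 (λ w → (con 3ℚ :- w) :+ w := con 3ℚ) refl

  sum-split : ∀ y a → y ≡ a ℚ.+ (y ℚ.- a)
  sum-split = solve 2 (λ y a → y := a :+ (y :- a)) refl

  halve : ∀ p → ½ ℚ.* (p ℚ.+ p) ≡ p
  halve = solve 1 (λ p → con ½ :* (p :+ p) := p) refl

  y-a<-w : ∀ y w a → y ℚ.+ w ℚ.< a → y ℚ.- a ℚ.< ℚ.- w
  y-a<-w y w a lt = subst₂ ℚ._<_
    (solve 3 (λ y w a → (y :+ w) :+ (:- w :- a) := y :- a) refl y w a)
    (solve 2 (λ w a → a :+ (:- w :- a) := :- w) refl w a)
    (ℚ.+-monoˡ-< (ℚ.- w ℚ.- a) lt)

ℓ∋⁻ : ∀ {p} → ℓ ∋ p → ∃[ w ] ¬ (√ 5ℚ ∋ w) × p ℚ.+ p ℚ.< 3ℚ ℚ.- w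
ℓ∋⁻ {p} (_ , (x , (_ , (a , b , (_ , refl , a<3) , (_ , (w , √5≤w , refl) , b<-w) , refl) , x<a+b) , refl) , p<½x) =
  w , √5≤w , (begin-strict
    p ℚ.+ p              <⟨ double p<½x ⟩
    ½ ℚ.* x ℚ.+ ½ ℚ.* x  ≡⟨ solve 1 (λ x → con ½ :* x :+ con ½ :* x := x) refl x ⟩
    x                    <⟨ x<a+b ⟩
    a ℚ.+ b              <⟨ ℚ.+-mono-< a<3 b<-w ⟩
    3ℚ ℚ.- w             ∎)
  where
  open ℚ.≤-Reasoning
  open ℚ.+-*-Solver

swap-sub : ∀ p q w → p ℚ.< q ℚ.- w → w ℚ.< q ℚ.- p
swap-sub p q w lt = subst₂ ℚ._<_
  (solve 2 (λ p w → p :+ (w :- p) := w) refl p w)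
  (solve 3 (λ p q w → (q :- w) :+ (w :- p) := q :- p) refl p q w)
  (ℚ.+-monoˡ-< (w ℚ.- p) lt)
  where open ℚ.+-*-Solver

-- Between 2q and 3 - w, where w bounds √5 from above, lies 2α. If α > 1 or α > (1 - α)², some
-- rational above `w` would have square at most 5: the number 1 in the first case, 3 - 2α in the
-- second. For negative `q`, α = 0 serves.
below-ℓ : ∀ {q} → ℓ ∋ q →
  ∃[ α ] q ℚ.< α × 0ℚ ℚ.≤ α × α ℚ.≤ 1ℚ × α ℚ.≤ (1ℚ ℚ.- α) ℚ.* (1ℚ ℚ.- α)
below-ℓ {q} q∈ with 0ℚ ℚ.≤? q
... | no  0≰q = 0ℚ , ℚ.≰⇒> 0≰q , ℚ.≤-refl , ℚ.≤ᵇ⇒≤ {0ℚ} {1ℚ} _ , ℚ.≤ᵇ⇒≤ {0ℚ} {(1ℚ ℚ.- 0ℚ) ℚ.* (1ℚ ℚ.- 0ℚ)} _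
... | yes 0≤q with ℓ∋⁻ q∈
... | w , √5≤w , 2q<3-w with ℚ.<-dense 2q<3-w
... | x , 2q<x , x<3-w = α , q<α , ℚ.≤-trans 0≤q (ℚ.<⇒≤ q<α) , α≤1 , golden
  where
  open ℚ.+-*-Solver
  α = ½ ℚ.* x

  2α≡x : α ℚ.+ α ≡ x
  2α≡x = solve 1 (λ x → con ½ :* x :+ con ½ :* x := x) refl x

  q<α : q ℚ.< α
  q<α = subst (ℚ._< α) (solve 1 (λ q → con ½ :* (q :+ q) := q) refl q) (ℚ.*-monoʳ-<-pos ½ 2q<x)

  w<3-2α : w ℚ.< 3ℚ ℚ.- (α ℚ.+ α)
  w<3-2α = swap-sub (α ℚ.+ α) 3ℚ w (subst (ℚ._< 3ℚ ℚ.- w) (sym 2α≡x) x<3-w)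

  α≤1 : α ℚ.≤ 1ℚ
  α≤1 = ℚ.≮⇒≥ λ 1<α → √5≤w (1ℚ , ℚ.≤ᵇ⇒≤ {1ℚ ℚ.* 1ℚ} {5ℚ} _ ,
    ℚ.<-trans w<3-2α (ℚ.+-monoʳ-< 3ℚ (ℚ.neg-antimono-< (double 1<α))))

  golden : α ℚ.≤ (1ℚ ℚ.- α) ℚ.* (1ℚ ℚ.- α)
  golden = 0≤q-p⇒p≤q (ℚ.*-cancelˡ-≤-pos 4ℚ (ℚ.≮⇒≥ λ neg → √5≤w (3ℚ ℚ.- (α ℚ.+ α) ,
    subst (ℚ._≤ 5ℚ) (sym (golden-identity α)) (ℚ.<⇒≤ (ℚ.+-monoʳ-< 5ℚ neg)) , w<3-2α)))

-- `k` and `b` are to be the sizes of the A-side and the B-side. The denominator exceeds `k` by `b`,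
-- so 1 - α is b / (k + b), and clearing denominators in the golden inequality gives the integer
-- one.
rational-golden : ∀ α → 0ℚ ℚ.≤ α → α ℚ.≤ 1ℚ → α ℚ.≤ (1ℚ ℚ.- α) ℚ.* (1ℚ ℚ.- α) →
  ∃[ k ] ∃[ b ] Σ (NonZero (k + b)) λ nz →
    k * (k + b) ≤ b * b × α ≡ (+ k / (k + b)) {{nz}}
rational-golden α 0≤α α≤1 golden with 0≤p⇒p≡k/n α 0≤α
... | k , n , refl with m≤n⇒∃[o]m+o≡n (subst₂ _≤_ (*-identityʳ k) (*-identityˡ (suc n))
                          (/-cancel-≤ k (suc n) 1 1 α≤1))
... | b , eq = k , b , nz , kn≤b² , ℚ./-cong {{_}} {{nz}} (refl {x = + k}) (sym eq)
  where
  nz : NonZero (k + b)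
  nz = subst NonZero (sym eq) _

  open ≡-Reasoning
  1-α : 1ℚ ℚ.- + k / suc n ≡ + b / suc n
  1-α = begin
    1ℚ ℚ.- + k / suc n                        ≡⟨ cong (ℚ._- + k / suc n) (n/n≡1 (suc n)) ⟨
    + suc n / suc n ℚ.- + k / suc n           ≡⟨ cong (λ m → + m / suc n ℚ.- + k / suc n) eq ⟨
    + (k + b) / suc n ℚ.- + k / suc n       ≡⟨ cong (ℚ._- + k / suc n) (/-+ k b (suc n)) ⟩
    + k / suc n ℚ.+ + b / suc n ℚ.- + k / suc n
      ≡⟨ solve 2 (λ x y → x :+ y :- x := y) refl (+ k / suc n) (+ b / suc n) ⟩
    + b / suc n                               ∎
    where open ℚ.+-*-Solver

  kn≤b² : k * (k + b) ≤ b * b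
  kn≤b² = *-cancelʳ-≤ _ _ (suc n) (subst (_≤ b * b * suc n)
    (trans (sym (*-assoc k (suc n) (suc n))) (cong (λ m → k * m * suc n) (sym eq)))
    (/-cancel-≤ k (suc n) (b * b) (suc n * suc n)
      (subst (+ k / suc n ℚ.≤_)
        (trans (cong₂ ℚ._*_ 1-α 1-α) (sym (/-* b b (suc n) (suc n)))) golden)))

below-ℓ-fraction : ∀ {q} → ℓ ∋ q → ∃[ k ] ∃[ b ] Σ (NonZero (k + b)) λ nz →
  let α = (+ k / (k + b)) {{nz}} in
  k * (k + b) ≤ b * b × q ℚ.< α × 0ℚ ℚ.≤ α × α ℚ.≤ 1ℚ
below-ℓ-fraction q∈ with below-ℓ q∈
... | α , q<α , 0≤α , α≤1 , golden with rational-golden α 0≤α α≤1 golden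
... | k , b , nz , kn≤b² , refl = k , b , nz , kn≤b² , q<α , 0≤α , α≤1

-- d′ / E is the last multiple of 1 / E with x ≤ (1 − x)², so it is within 1 / E of τ.
golden-grid : ∀ d b → .{{NonZero (d + b)}} → d * (d + b) ≤ b * b →
  ∃[ d′ ] ∃[ b′ ] suc d′ + b′ ≡ d + b ×
    d′ * (suc d′ + b′) ≤ suc b′ * suc b′ × b′ * b′ ≤ suc d′ * (suc d′ + b′)
golden-grid (suc d) zero    le with () ← le
golden-grid d       (suc b) le with b * b ≤? suc d * (suc d + b)
... | yes le′ = d , b , sym (+-suc d b) ,
                subst (λ e → d * e ≤ suc b * suc b) (+-suc d b) le , le′
... | no  nle = let d′ , b′ , eq , p , q = golden-grid (suc d) b (≰⇒≥ nle)
                in d′ , b′ , trans eq (sym (+-suc d b)) , p , q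

-- The denominator is also `d + suc b`, so the hypothesis says D ≤ (1 - D)² for D = d / E. Hence √5
-- ≤ 3 - 2D, that is, D is at most the limit.
ℓ-below : ∀ d b → d * (suc d + b) ≤ suc b * suc b → ∀ {p} → p ℚ.< + d / (suc d + b) → ℓ ∋ p
ℓ-below d b le {p} p<D = ℓ∋⁺ (golden⇒√5≤ D D≤1 D≤B²)
  (subst (p ℚ.+ p ℚ.<_) (solve 1 (λ x → x :+ x := con 3ℚ :- (con 3ℚ :- (x :+ x))) refl D) (double p<D))
  where
  open ℚ.+-*-Solver
  E = suc d + b
  D = + d / E

  D≤1 : D ℚ.≤ 1ℚ
  D≤1 = /-mono-≤ d E 1 1 (subst₂ _≤_ (sym (*-identityʳ d)) (sym (*-identityˡ E))
          (≤-trans (n≤1+n d) (m≤m+n (suc d) b)))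

  1-D : 1ℚ ℚ.- D ≡ + suc b / E
  1-D = trans (cong (ℚ._- D) (trans (sym (n/n≡1 E))
          (trans (cong (λ m → + m / E) (sym (+-suc d b))) (/-+ d (suc b) E))))
        (solve 2 (λ x y → x :+ y :- x := y) refl D (+ suc b / E))

  D≤B² : D ℚ.≤ (1ℚ ℚ.- D) ℚ.* (1ℚ ℚ.- D)
  D≤B² = subst (D ℚ.≤_) (trans (/-* (suc b) (suc b) E E) (sym (cong₂ ℚ._*_ 1-D 1-D)))
    (/-mono-≤ d E (suc b * suc b) (E * E)
      (subst (_≤ suc b * suc b * E) (*-assoc d E E) (*-monoˡ-≤ E le)))

-- The two bounds and the limit

extremal-density : ∀ m k b .{{_ : NonZero (k + b)}} → k * (k + b) ≤ b * b →
  + k / (k + b) ℚ.≤ 1ℚ → + k / (k + b) ℚ.≤ partiteDensity (Extremal.G m k b)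
extremal-density m k b kn≤b² α≤1 = ≤-partiteDensity G α≤1 λ i j i<j →
  ≤-density G k (k + b) i j (dense kn≤b² i j i<j)
  where open Extremal m k b using (G; dense)

-- There is no error term: above each rational below the limit lies some k / (k + b) attained by the
-- extremal graph, for every positive number of copies.
lower-bound : ∀ r t′ (F : Graph (suc t′)) → ¬ HasStarComponent F →
  ℓ ≤ᴿ π (suc r * suc t′) (copies (suc r) F)
lower-bound r t′ F no-star q q∈ = attained (below-ℓ-fraction q∈)
  where
  attained : (∃[ k ] ∃[ b ] Σ (NonZero (k + b)) λ nz →
      let α = (+ k / (k + b)) {{nz}} in
      k * (k + b) ≤ b * b × q ℚ.< α × 0ℚ ℚ.≤ α × α ℚ.≤ 1ℚ) →
    π (suc r * suc t′) (copies (suc r) F) ∋ q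
  attained (k , b , nz , kn≤b² , q<α , 0≤α , α≤1) =
    (+ k / (k + b)) {{nz}} ,
    (0≤α , α≤1 , Extremal.G (t′ + r * suc t′) k b {{nz}} ,
     extremal-density (t′ + r * suc t′) k b {{nz}} kn≤b² α≤1 ,
     no-traversal r t′ F no-star k b {{nz}}) , q<α

ℓ-ε≤ℓ : ∀ {ε} → 0ℚ ℚ.< ε → ℓ - ι ε ≤ᴿ ℓ
ℓ-ε≤ℓ {ε} 0<ε q (_ , (p , _ , p∈ , (_ , (w , ε≤w , refl) , b<-w) , refl) , q<p+b) =
  ℝ̄.lower ℓ (ℚ.<-trans q<p+b (subst (p ℚ.+ _ ℚ.<_) (ℚ.+-identityʳ p)
    (ℚ.+-monoʳ-< p (ℚ.<-trans b<-w (ℚ.neg-antimono-< 0<w))))) p∈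
  where
  0<w : 0ℚ ℚ.< w
  0<w = ℚ.<-≤-trans 0<ε (ℚ.≮⇒≥ λ w<ε → ε≤w (ε , refl , w<ε))

-- d / E is at most the limit, and lowering it by 1 / E makes the inequality strict. From there (d +
-- 2) / E is 3 / E away, whence the 3 in the condition on ε.
ℓ+ε-above : ∀ ε d b → + 3 / (suc d + b) ℚ.< ε → d * (suc d + b) ≤ suc b * suc b →
  ∀ {q} → q ℚ.< + suc (suc d) / (suc d + b) → (ℓ +ᴿ ι ε) ∋ q
ℓ+ε-above ε d b 3/E<ε below q< =
  + suc (suc d) / E , (D ℚ.- δ , + 3 / E , ℓ-below d b below D-δ<D , (ε , refl , 3/E<ε) , sum) , q<
  where
  E = suc d + b
  D = + d / E
  δ = + 1 / E

  D-δ<D : D ℚ.- δ ℚ.< D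
  D-δ<D = subst (D ℚ.- δ ℚ.<_) (ℚ.+-identityʳ D)
    (ℚ.+-monoʳ-< D (ℚ.neg-antimono-< (/-mono-< 0 1 1 E (s≤s z≤n))))

  sum : + suc (suc d) / E ≡ D ℚ.- δ ℚ.+ + 3 / E
  sum = trans (/-+ 2 d E) (trans
    (solve 3 (λ D δ two → two :+ D := D :- δ :+ (δ :+ two)) refl D δ (+ 2 / E))
    (cong (D ℚ.- δ ℚ.+_) (sym (/-+ 1 2 E))))
    where open ℚ.+-*-Solver

-- The parameter c of `has-traversal` is `suc d` here. Densities of at least (c + 1) / E force a
-- traversal, so every α in the supremum is below (d + 2) / E.
upper-bound : ∀ t′ (F : Graph (suc t′)) → Bipartite F → ∀ ε d b →
  + 3 / (suc d + b) ℚ.< ε → d * (suc d + b) ≤ suc b * suc b →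
  b * b ≤ suc d * (suc d + b) →
  ∀ r → traversal-bound t′ (suc d) b ≤ r → π (r * suc t′) (copies r F) ≤ᴿ ℓ +ᴿ ι ε
upper-bound t′ F bip ε d b 3/E<ε below above r r≥ q (α , (0≤α , α≤1 , G , α≤G , none) , q<α) =
  ℓ+ε-above ε d b 3/E<ε below (ℚ.<-trans q<α (ℚ.≰⇒> λ c+1≤α →
    none (has-traversal t′ F bip (suc d) b above r r≥ G λ i j i<j →
      ≤-density⁻¹ G (suc (suc d)) (suc d + b) i j
        (ℚ.≤-trans c+1≤α (ℚ.≤-trans α≤G (partiteDensity-≤ G i j i<j))))))

grid : ∀ ε → 0ℚ ℚ.< ε → ∃[ d ] ∃[ b ]
  + 3 / (suc d + b) ℚ.< ε ×
  d * (suc d + b) ≤ suc b * suc b × b * b ≤ suc d * (suc d + b)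
grid ε 0<ε with 0<p⇒p≡k/n ε 0<ε
-- Denominator 4 (e + 1) puts 3 / E below 1 / (e + 1), which is at most ε. The search starts from d
-- = 0, where its inequality is trivial.
... | a , e , refl with golden-grid 0 (4 * suc e) z≤n
... | d , b , E≡ , below , above =
  d , b , /-mono-< 3 (suc d + b) (suc a) (suc e) (begin-strict
    3 * suc e               <⟨ *-monoˡ-< (suc e) (n<1+n 3) ⟩
    4 * suc e               ≡⟨ E≡ ⟨
    suc d + b             ≤⟨ m≤n*m (suc d + b) (suc a) ⟩
    suc a * (suc d + b)   ∎) , below , above
  where open ≤-Reasoning

theorem1p5 : (t : ℕ) .{{_ : NonZero t}} (F : Graph t) →
    Bipartite F → ¬ HasStarComponent F →
    (λ r → π (r * t) (copies r F)) ⟶ (ι (+ 3 / 1) - √ (+ 5 / 1)) /2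
theorem1p5 (suc t′) F bip no-star ε 0<ε = bounds (grid ε 0<ε)
  where
  bounds : (∃[ d ] ∃[ b ] + 3 / (suc d + b) ℚ.< ε ×
      d * (suc d + b) ≤ suc b * suc b × b * b ≤ suc d * (suc d + b)) →
    ∃[ N ] ∀ r → N ≤ r →
      (ℓ - ι ε ≤ᴿ π (r * suc t′) (copies r F)) × (π (r * suc t′) (copies r F) ≤ᴿ ℓ +ᴿ ι ε)
  bounds (d , b , 3/E<ε , below , above) = traversal-bound t′ (suc d) b , close
    where
    close : ∀ r → traversal-bound t′ (suc d) b ≤ r →
      (ℓ - ι ε ≤ᴿ π (r * suc t′) (copies r F)) × (π (r * suc t′) (copies r F) ≤ᴿ ℓ +ᴿ ι ε)
    -- The threshold is positive, so there is at least one copy of `F` for the lower bound to use.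
    close zero    ()
    close (suc r) r≥ =
      (λ q q∈ → lower-bound r t′ F no-star q (ℓ-ε≤ℓ 0<ε q q∈)) ,
      upper-bound t′ F bip ε d b 3/E<ε below above (suc r) r≥
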